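{- Let $G$ be a graph obtained from a simple cubic graph by replacing some of its edges with paths of length at least five (each replaced edge $uv$ is deleted and replaced by a path from $u$ to $v$ with at least five edges whose internal vertices are new; the lengths may differ for different edges). Then $\operatorname{lir}(^2G)\leq 2$.
   Context: All graphs are finite and without loops. A cubic graph is a 3-regular graph. The length of a path is its number of edges. A multigraph $M$ consists of a nonempty finite vertex set and a multiset of edges (2-element subsets of the vertex set); the degree of a vertex is the sum of the multiplicities of the edges incident to it. For a simple graph $G$, $^2G$ denotes the 2-multigraph obtained from $G$ by replacing each edge of $G$ with two parallel edges. A multigraph is locally irregular if every two adjacent vertices have different degrees. An edge coloring of a multigraph $M$ assigns a color to each element of the edge multiset (it need not be proper, and parallel edges may receive different colors); it is locally irregular if, for each color, the submultigraph of $M$ induced by the edges of that color is locally irregular. The locally irregular chromatic index $\operatorname{lir}(M)$ is the smallest number of colors in a locally irregular edge coloring of $M$, if one exists; so $\operatorname{lir}(M)\leq k$ means that $M$ has a locally irregular edge coloring using at most $k$ colors. -}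

module Defs where

open import Data.Fin.Base using (Fin; zero; suc; inject₁)
open import Data.Fin.Properties as Fin using ()
open import Data.Fin.Relation.Unary.Top using (View; view; ‵fromℕ; ‵inject₁)
open import Data.List.Base using (List; []; _∷_; _++_; map; concatMap; filter; length; allFin)
open import Data.List.Membership.Propositional using (_∈_)
open import Data.List.Membership.Propositional.Properties
  using (∈-allFin; ∈-map⁺; ∈-map⁻; ∈-++⁺ˡ; ∈-++⁺ʳ; ∈-concatMap⁺; ∈-concatMap⁻)
open import Data.List.Relation.Unary.All as All using ([])
open import Data.List.Relation.Unary.Any as Any using (here)
open import Data.List.Relation.Unary.AllPairs using ([]; _∷_)
open import Data.List.Relation.Unary.Unique.Propositional using (Unique)
import Data.List.Relation.Unary.Unique.Propositional.Properties as Unique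
open import Data.Nat.Base using (ℕ; suc)
open import Data.Product.Base using (Σ; ∃-syntax; _×_; _,_; proj₁; proj₂)
import Data.Product.Properties as Product
open import Data.Sum.Base using (_⊎_; inj₁; inj₂)
import Data.Sum.Properties as Sum
open import Function.Base using (_∘_)
open import Relation.Binary.Definitions using (DecidableEquality)
open import Relation.Binary.PropositionalEquality
  using (_≡_; _≢_; refl; sym)
open import Axiom.UniquenessOfIdentityProofs using (module Decidable⇒UIP)
open import Relation.Nullary.Decidable.Core using (Dec; yes; no; _⊎-dec_)
open import Relation.Nullary.Negation.Core using (contradiction)

record Finite (A : Set) : Set where
  field
    _≟_      : DecidableEquality A
    elements : List A
    unique   : Unique elements
    complete : ∀ x → x ∈ elements

Fin-finite : ∀ n → Finite (Fin n)
Fin-finite n = record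
  { _≟_      = Fin._≟_
  ; elements = allFin n
  ; unique   = Unique.allFin⁺ n
  ; complete = ∈-allFin
  }

⊎-finite : ∀ {A B} → Finite A → Finite B → Finite (A ⊎ B)
⊎-finite {A} {B} FA FB = record
  { _≟_      = Sum.≡-dec A._≟_ B._≟_
  ; elements = map inj₁ A.elements ++ map inj₂ B.elements
  ; unique   = Unique.++⁺ (Unique.map⁺ Sum.inj₁-injective A.unique)
                          (Unique.map⁺ Sum.inj₂-injective B.unique)
                          λ { (p , q) → disjoint (∈-map⁻ inj₁ p) (∈-map⁻ inj₂ q) }
  ; complete = λ { (inj₁ x) → ∈-++⁺ˡ (∈-map⁺ inj₁ (A.complete x))
                 ; (inj₂ y) → ∈-++⁺ʳ _ (∈-map⁺ inj₂ (B.complete y)) }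
  }
  where
  module A = Finite FA
  module B = Finite FB
  disjoint : ∀ {z C} → ∃[ x ] x ∈ A.elements × z ≡ inj₁ x →
             ∃[ y ] y ∈ B.elements × z ≡ inj₂ y → C
  disjoint (_ , _ , refl) (_ , _ , ())

Σ-finite : ∀ {A} {B : A → Set} → Finite A → (∀ x → Finite (B x)) → Finite (Σ A B)
Σ-finite {A} {B} FA FB = record
  { _≟_      = Product.≡-dec A._≟_ (B._≟_ _)
  ; elements = concatMap fibre A.elements
  ; unique   = concatMap-unique A.unique
  ; complete = λ { (x , y) → ∈-concatMap⁺ fibre
                   (Any.map (λ { refl → ∈-map⁺ (x ,_) (B.complete x y) }) (A.complete x)) }
  }
  where
  module A = Finite FA
  module B x = Finite (FB x)

  fibre : ∀ x → List (Σ A B)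
  fibre x = map (x ,_) (B.elements x)

  ,-injective : ∀ {x} {y z : B x} → (x , y) ≡ (x , z) → y ≡ z
  ,-injective = Product.,-injectiveʳ-UIP (Decidable⇒UIP.≡-irrelevant A._≟_)

  base : ∀ {x z} → z ∈ fibre x → proj₁ z ≡ x
  base p with ∈-map⁻ (_ ,_) p
  ... | _ , _ , refl = refl

  base-∈ : ∀ xs {z} → z ∈ concatMap fibre xs → proj₁ z ∈ xs
  base-∈ xs p = Any.map base (∈-concatMap⁻ fibre {xs = xs} p)

  concatMap-unique : ∀ {xs} → Unique xs → Unique (concatMap fibre xs)
  concatMap-unique [] = []
  concatMap-unique {x ∷ xs} (x∉xs ∷ u) =
    Unique.++⁺ (Unique.map⁺ ,-injective (B.unique x)) (concatMap-unique u)
      λ { (p , q) → All.lookup x∉xs (base-∈ xs q) (sym (base p)) }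

≡-finite : ∀ {A : Set} → DecidableEquality A → (x y : A) → Finite (x ≡ y)
≡-finite _≟_ x y = record
  { _≟_      = λ p q → yes (irrelevant p q)
  ; elements = elems (x ≟ y)
  ; unique   = elems-unique (x ≟ y)
  ; complete = λ p → elems-complete (x ≟ y) p
  }
  where
  irrelevant = Decidable⇒UIP.≡-irrelevant _≟_

  elems : Dec (x ≡ y) → List (x ≡ y)
  elems (yes p) = p ∷ []
  elems (no  _) = []

  elems-unique : ∀ d → Unique (elems d)
  elems-unique (yes p) = [] ∷ []
  elems-unique (no  _) = []

  elems-complete : ∀ d p → p ∈ elems d
  elems-complete (yes q) p = here (irrelevant p q)
  elems-complete (no ¬p) p = contradiction p ¬p

-- The multiset of edges is a finite family of pairs of distinct vertices.
-- The order inside each pair is an artefact of the encoding: everything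
-- below depends on it at most up to isomorphism.

record Multigraph : Set₁ where
  field
    Vertex        : Set
    Edge          : Set
    vertex-finite : Finite Vertex
    edge-finite   : Finite Edge
    nonempty      : Vertex
    ends          : Edge → Vertex × Vertex
    loopless      : ∀ e → proj₁ (ends e) ≢ proj₂ (ends e)

  open Finite vertex-finite public using () renaming (_≟_ to _≟ᵛ_; elements to vertices)
  open Finite edge-finite   public using () renaming (_≟_ to _≟ᵉ_; elements to edges)

  Joins : Edge → Vertex → Vertex → Set
  Joins e u v = ends e ≡ (u , v) ⊎ ends e ≡ (v , u)

  Adjacent : Vertex → Vertex → Set
  Adjacent u v = ∃[ e ] Joins e u v

  Incident : Vertex → Edge → Set
  Incident v e = v ≡ proj₁ (ends e) ⊎ v ≡ proj₂ (ends e)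

  incident? : ∀ v e → Dec (Incident v e)
  incident? v e = (v ≟ᵛ proj₁ (ends e)) ⊎-dec (v ≟ᵛ proj₂ (ends e))

  degree : Vertex → ℕ
  degree v = length (filter (incident? v) edges)

open Multigraph

IsSimple : Multigraph → Set
IsSimple G = ∀ {e f u v} → Joins G e u v → Joins G f u v → e ≡ f

IsRegular : ℕ → Multigraph → Set
IsRegular d G = ∀ v → degree G v ≡ d

IsCubic : Multigraph → Set
IsCubic = IsRegular 3

LocallyIrregular : Multigraph → Set
LocallyIrregular M = ∀ u v → Adjacent M u v → degree M u ≢ degree M v

²_ : Multigraph → Multigraph
² G = record
  { Vertex        = Vertex G
  ; Edge          = Edge G × Fin 2
  ; vertex-finite = vertex-finite G
  ; edge-finite   = Σ-finite (edge-finite G) (λ _ → Fin-finite 2)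
  ; nonempty      = nonempty G
  ; ends          = ends G ∘ proj₁
  ; loopless      = loopless G ∘ proj₁
  }

EdgeColouring : Multigraph → ℕ → Set
EdgeColouring M k = Edge M → Fin k

-- The submultigraph induced by a colour class.  Vertices not incident to
-- that colour are kept, as isolated vertices, which does not affect local
-- irregularity and lets a colour be unused.

colourClass : ∀ M {k} → EdgeColouring M k → Fin k → Multigraph
colourClass M χ c = record
  { Vertex        = Vertex M
  ; Edge          = ∃[ e ] χ e ≡ c
  ; vertex-finite = vertex-finite M
  ; edge-finite   = Σ-finite (edge-finite M) (λ e → ≡-finite Fin._≟_ (χ e) c)
  ; nonempty      = nonempty M
  ; ends          = ends M ∘ proj₁
  ; loopless      = loopless M ∘ proj₁
  }

IsLocallyIrregularColouring : ∀ M {k} → EdgeColouring M k → Set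
IsLocallyIrregularColouring M χ = ∀ c → LocallyIrregular (colourClass M χ c)

-- The locally irregular chromatic index of M exists and is at most k.

lir[_]≤_ : Multigraph → ℕ → Set
lir[ M ]≤ k = ∃[ χ ] IsLocallyIrregularColouring M {k} χ

-- Each edge e is replaced with a path having inner e new internal
-- vertices, that is, suc (inner e) edges.  Thus inner e ≡ 0 leaves e as it
-- is.  The i-th edge of the path joins source e i to target e i.

module _ (H : Multigraph) (inner : Edge H → ℕ) where

  PathVertex : Set
  PathVertex = Vertex H ⊎ (∃[ e ] Fin (inner e))

  source : ∀ e → Fin (suc (inner e)) → PathVertex
  source e zero    = inj₁ (proj₁ (ends H e))
  source e (suc j) = inj₂ (e , j)

  targetView : ∀ e {i : Fin (suc (inner e))} → View i → PathVertex
  targetView e ‵fromℕ       = inj₁ (proj₂ (ends H e))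
  targetView e (‵inject₁ j) = inj₂ (e , j)

  target : ∀ e → Fin (suc (inner e)) → PathVertex
  target e i = targetView e (view i)

  private
    suc≢inject₁ : ∀ {n} {j k : Fin n} → suc j ≡ inject₁ k → j ≢ k
    suc≢inject₁ {j = suc j} eq refl = suc≢inject₁ (Fin.suc-injective eq) refl

    source≢targetView : ∀ e i i′ (w : View i′) → i ≡ i′ → source e i ≢ targetView e w
    source≢targetView e zero    _ ‵fromℕ       _  eq = loopless H e (Sum.inj₁-injective eq)
    source≢targetView e zero    _ (‵inject₁ j) _  ()
    source≢targetView e (suc i) _ ‵fromℕ       _  ()
    source≢targetView e (suc i) _ (‵inject₁ j) eq eq′ =
      suc≢inject₁ eq (Product.,-injectiveʳ-UIP
        (Decidable⇒UIP.≡-irrelevant (_≟ᵉ_ H)) (Sum.inj₂-injective eq′))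

  replaceByPaths : Multigraph
  replaceByPaths = record
    { Vertex        = PathVertex
    ; Edge          = ∃[ e ] Fin (suc (inner e))
    ; vertex-finite = ⊎-finite (vertex-finite H)
                        (Σ-finite (edge-finite H) (Fin-finite ∘ inner))
    ; edge-finite   = Σ-finite (edge-finite H) (Fin-finite ∘ suc ∘ inner)
    ; nonempty      = inj₁ (nonempty H)
    ; ends          = λ { (e , i) → source e i , target e i }
    ; loopless      = λ { (e , i) → source≢targetView e i i (view i) refl }
    }

{-# OPTIONS --safe #-}

-- It suffices to give the edges of the cubic graph weights in {0,1,2} such
-- that adjacent vertices have different totals: an edge of weight a becomes
-- a parallel edges of one colour and 2 − a of the other.  On a replaced edge
-- of weight w the path gets weights w, b, …, c, w such that weights at
-- distance two differ; since the totals of the two ends differ, b and c can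
-- be chosen different and compatible with them.
--
-- To weigh one component, take a maximal path and the longest cycle C formed
-- by an initial segment of it, so that all neighbours of one vertex of C lie
-- on C.  If C spans the component, the vertices are settled one after the
-- other along C, ending with an end v₀ of an innermost chord whose total is
-- made to exceed those of its neighbours.  Otherwise the component is
-- 3-colourable (Zając's argument for Brooks' theorem), and the weights can be
-- chosen so that the totals modulo 3 are prescribed at all vertices but one;
-- an odd closed walk corrects the last vertex, and if there is none the
-- bipartition prescribes 0 on one side and nonzero residues on the other.

module Submission where

open import Defs
open import Data.Bool.Base using (Bool; true; false; not; if_then_else_)
import Data.Bool.Properties as Bool
open import Data.Empty using (⊥; ⊥-elim)
open import Data.Fin.Base using (Fin; zero; suc; toℕ; fromℕ; fromℕ<; inject₁)
import Data.Fin.Properties as Fin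
open import Data.Fin.Properties using (all?; any?) renaming (_≟_ to _≟³_)
open import Data.Fin.Relation.Unary.Top using (View; view; ‵fromℕ; ‵inject₁; view-fromℕ; view-inject₁)
open import Data.List.Base
  using (List; []; _∷_; _++_; map; concatMap; filter; length; allFin; reverse; initLast; _∷ʳ′_)
open import Data.List.Membership.Propositional using (_∈_; _∉_; find; lose)
open import Data.List.Membership.Propositional.Properties
  using (∈-++⁺ˡ; ∈-++⁺ʳ; ∈-++⁻; ∈-∃++; ∈-filter⁺; ∈-filter⁻; ∈-map⁺; ∈-map⁻)
open import Data.List.Membership.Propositional.Properties.WithK using (unique∧set⇒bag)
open import Data.List.Properties
  using (++-assoc; ++-identityʳ; reverse-++; unfold-reverse; filter-accept; filter-reject; filter-notAll;
         map-∘; map-cong; map-cong-local)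
open import Data.List.Relation.Binary.BagAndSetEquality using (∼bag⇒↭)
open import Data.List.Relation.Binary.Permutation.Propositional using (_↭_; ↭-sym; ↭-trans; ↭-prep; ↭⇒↭ₛ)
open import Data.List.Relation.Binary.Permutation.Propositional.Properties as ↭
  using (∈-resp-↭; ↭-reverse; ++-comm)
import Data.List.Relation.Binary.Permutation.Setoid.Properties as ↭ₛ
open import Data.List.Relation.Unary.All as All using ([]; _∷_)
import Data.List.Relation.Unary.All.Properties as All
open import Data.List.Relation.Unary.AllPairs using ([]; _∷_)
open import Data.List.Relation.Unary.Any as Any using (Any; here; there)
open import Data.List.Relation.Unary.Linked as Linked using (Linked; []; [-]; _∷_)
open import Data.List.Relation.Unary.Unique.Propositional using (Unique)
import Data.List.Relation.Unary.Unique.Propositional.Properties as Unique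
open import Data.Maybe.Base using (Maybe; just; nothing; fromMaybe)
open import Data.Maybe.Properties using (just-injective)
open import Data.Nat.Base using (ℕ; zero; suc; _+_; _*_; _∸_; _≤_; _<_; z≤n; s≤s)
open import Data.Nat.ListAction using (sum)
open import Data.Nat.ListAction.Properties using (sum-↭)
import Data.Nat.Properties as ℕ
open import Data.Product.Base using (∃-syntax; _×_; _,_; proj₁; proj₂)
import Data.Product.Properties as Product
open import Data.Sum.Base as Sum using (_⊎_; inj₁; inj₂; swap)
import Data.Sum.Properties as Sum
open import Function.Base using (_∘_; _∋_; case_of_)
open import Function.Bundles using (mk⇔)
open import Algebra.Properties.CommutativeSemigroup ℕ.+-commutativeSemigroup using (interchange)
open import Axiom.UniquenessOfIdentityProofs using (module Decidable⇒UIP)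
open import Relation.Binary.Definitions using (DecidableEquality; Symmetric)
open import Relation.Binary.PropositionalEquality
open import Relation.Nullary.Decidable
  using (Dec; yes; no; does; dec-true; dec-false; ¬?; from-yes; map′; _×-dec_; _⊎-dec_; _→-dec_)
open import Relation.Nullary.Negation using (¬_; contradiction)
open import Relation.Unary using (Decidable)

-- One weighting serves both colours: a vertex of the cubic graph with total `s` has degree `s` in
-- colour 0 and `6 - s` in colour 1. Consecutive inner vertices of a path share an edge, so
-- comparing their degrees compares the weights two places apart. In `w, b, m, c, w` these
-- conditions relate `b` and `c` only to each other; with four edges they would also be compared
-- with `w`, and five is the least length that avoids this. The delicate end has total 3 and
-- `w = 1`, where only `b = 1` is allowed. Two such ends would force `b = c`, so distinct totals
-- matter on replaced edges as well. Two methods are needed for the weights. The residues modulo 3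
-- are exactly the available weights, which makes charges freely adjustable, but prescribing them
-- asks for a 3-colouring, and the complete graph on four vertices has none. Settling vertices one
-- after the other asks for no colouring, but the last vertex has no edge to an unsettled neighbour
-- left. It must therefore win by size, and the innermost chord is what keeps all three of its
-- neighbours small.

-- Residues modulo 3

next : Fin 3 → Fin 3
next zero             = suc zero
next (suc zero)       = suc (suc zero)
next (suc (suc zero)) = zero

infixl 6 _⊕_
infix  8 ⊖_

_⊕_ : Fin 3 → Fin 3 → Fin 3
zero           ⊕ b = b
suc zero       ⊕ b = next b
suc (suc zero) ⊕ b = next (next b)

-- Modulo 3 the negative of `a` is `2a`.
⊖_ : Fin 3 → Fin 3
⊖ a = a ⊕ a

⊕-assoc : ∀ a b c → (a ⊕ b) ⊕ c ≡ a ⊕ (b ⊕ c)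
⊕-assoc = from-yes (all? λ a → all? λ b → all? λ c → (a ⊕ b) ⊕ c ≟³ a ⊕ (b ⊕ c))

⊕-comm : ∀ a b → a ⊕ b ≡ b ⊕ a
⊕-comm = from-yes (all? λ a → all? λ b → a ⊕ b ≟³ b ⊕ a)

⊕-identityʳ : ∀ a → a ⊕ zero ≡ a
⊕-identityʳ = from-yes (all? λ a → a ⊕ zero ≟³ a)

⊕-inverse-absorb : ∀ a b c → b ⊕ c ≡ zero → a ⊕ b ⊕ c ≡ a
⊕-inverse-absorb a b c eq = trans (⊕-assoc a b c) (trans (cong (a ⊕_) eq) (⊕-identityʳ a))

⊕-cancelʳ : ∀ c a b → a ⊕ c ≡ b ⊕ c → a ≡ b
⊕-cancelʳ c a b eq = trans (sym (undo a c)) (trans (cong (_⊕ (⊖ c)) eq) (undo b c))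
  where
  undo : ∀ a c → (a ⊕ c) ⊕ (⊖ c) ≡ a
  undo = from-yes (all? λ a → all? λ c → (a ⊕ c) ⊕ (⊖ c) ≟³ a)

avoid₂ : ∀ (a b : Fin 3) → ∃[ c ] c ≢ a × c ≢ b
avoid₂ = from-yes (all? λ (a : Fin 3) → all? λ (b : Fin 3) → any? λ (c : Fin 3) → ¬? (c ≟³ a) ×-dec ¬? (c ≟³ b))

residue : ℕ → Fin 3
residue zero    = zero
residue (suc n) = next (residue n)

residue-+ : ∀ m n → residue (m + n) ≡ residue m ⊕ residue n
residue-+ zero    n = refl
residue-+ (suc m) n = trans (cong next (residue-+ m n)) (sym (⊕-assoc (suc zero) (residue m) (residue n)))

residue-toℕ : ∀ a → residue (toℕ a) ≡ a
residue-toℕ = from-yes (all? λ a → residue (toℕ a) ≟³ a)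

-- Each of the two forbidden totals excludes at most one summand.
avoid-totals : ∀ n p q → ∃[ a ] n + toℕ {3} a ≢ p × n + toℕ a ≢ q
avoid-totals n p q =
  let b , ¬b = excluded p ; c , ¬c = excluded q ; a , a≢b , a≢c = avoid₂ b c
  in a , ¬b a a≢b , ¬c a a≢c
  where
  excluded : ∀ p → ∃[ b ] (∀ a → a ≢ b → n + toℕ {3} a ≢ p)
  excluded p with any? (λ b → n + toℕ {3} b ℕ.≟ p)
  ... | no  none     = zero , λ a _ eq → none (a , eq)
  ... | yes (b , eq) = b , λ a a≢b eq′ →
    a≢b (Fin.toℕ-injective (ℕ.+-cancelˡ-≡ n _ _ (trans eq′ (sym eq))))

-- Against a single forbidden total the weights 0 and 1 suffice. The bound is what later keeps the
-- neighbours of `v₀` below the total of `v₀`.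
avoid-total : ∀ n p → ∃[ a ] toℕ {3} a ≤ 1 × n + toℕ a ≢ p
avoid-total n p with n ℕ.≟ p
... | no  n≢p  = zero , z≤n , λ eq → n≢p (trans (sym (ℕ.+-identityʳ n)) eq)
... | yes refl = suc zero , ℕ.≤-refl , λ eq → ℕ.1+n≢n (trans (ℕ.+-comm 1 n) eq)

-- Changing one value of a function, and sums over lists

module _ {A : Set} (_≟_ : DecidableEquality A) where

  infixl 7 _[_≔_]

  _[_≔_] : ∀ {B : Set} → (A → B) → A → B → A → B
  (f [ a ≔ b ]) x with x ≟ a
  ... | yes _ = b
  ... | no  _ = f x

  update-≡ : ∀ {B : Set} (f : A → B) a b → (f [ a ≔ b ]) a ≡ b
  update-≡ f a b with a ≟ a
  ... | yes _  = refl
  ... | no a≢a = contradiction refl a≢a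

  update-≢ : ∀ {B : Set} (f : A → B) a b {x} → x ≢ a → (f [ a ≔ b ]) x ≡ f x
  update-≢ f a b {x} x≢a with x ≟ a
  ... | yes x≡a = contradiction x≡a x≢a
  ... | no  _   = refl

  sum-update-∉ : ∀ (f : A → Fin 3) a b xs → a ∉ xs →
                 sum (map (toℕ ∘ (f [ a ≔ b ])) xs) ≡ sum (map (toℕ ∘ f) xs)
  sum-update-∉ f a b []       _    = refl
  sum-update-∉ f a b (x ∷ xs) a∉xs = cong₂ _+_
    (cong toℕ (update-≢ f a b (a∉xs ∘ here ∘ sym)))
    (sum-update-∉ f a b xs (a∉xs ∘ there))

  -- The old value is added on the left rather than subtracted on the right, because subtraction of
  -- natural numbers truncates.
  sum-update-∈ : ∀ (f : A → Fin 3) a b xs → Unique xs → a ∈ xs →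
                 sum (map (toℕ ∘ (f [ a ≔ b ])) xs) + toℕ (f a) ≡ sum (map (toℕ ∘ f) xs) + toℕ b
  sum-update-∈ f a b (.a ∷ xs) (a# ∷ _) (here refl) = begin
    toℕ ((f [ a ≔ b ]) a) + sum (map (toℕ ∘ (f [ a ≔ b ])) xs) + toℕ (f a)
      ≡⟨ cong₂ (λ c s → toℕ c + s + toℕ (f a)) (update-≡ f a b) (sum-update-∉ f a b xs λ a∈ → All.lookup a# a∈ refl) ⟩
    toℕ b + sum (map (toℕ ∘ f) xs) + toℕ (f a)
      ≡⟨ cong (_+ toℕ (f a)) (ℕ.+-comm (toℕ b) _) ⟩
    sum (map (toℕ ∘ f) xs) + toℕ b + toℕ (f a)
      ≡⟨ ℕ.+-comm (sum (map (toℕ ∘ f) xs) + toℕ b) (toℕ (f a)) ⟩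
    toℕ (f a) + (sum (map (toℕ ∘ f) xs) + toℕ b)
      ≡⟨ ℕ.+-assoc (toℕ (f a)) _ _ ⟨
    toℕ (f a) + sum (map (toℕ ∘ f) xs) + toℕ b ∎
    where open ≡-Reasoning
  sum-update-∈ f a b (x ∷ xs) (x# ∷ u) (there a∈xs) = begin
    toℕ ((f [ a ≔ b ]) x) + sum (map (toℕ ∘ (f [ a ≔ b ])) xs) + toℕ (f a)
      ≡⟨ ℕ.+-assoc (toℕ ((f [ a ≔ b ]) x)) _ _ ⟩
    toℕ ((f [ a ≔ b ]) x) + (sum (map (toℕ ∘ (f [ a ≔ b ])) xs) + toℕ (f a))
      ≡⟨ cong₂ _+_ (cong toℕ (update-≢ f a b (All.lookup x# a∈xs))) (sum-update-∈ f a b xs u a∈xs) ⟩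
    toℕ (f x) + (sum (map (toℕ ∘ f) xs) + toℕ b)
      ≡⟨ ℕ.+-assoc (toℕ (f x)) _ _ ⟨
    toℕ (f x) + sum (map (toℕ ∘ f) xs) + toℕ b ∎
    where open ≡-Reasoning

module _ {A : Set} (FA : Finite A) where

  open Finite FA

  -- A list that only grows by new elements of a finite type stops growing.
  saturate : ∀ {Inv Done : List A → Set} →
             (∀ L → Inv L → (∃[ x ] x ∉ L × Inv (x ∷ L)) ⊎ Done L) →
             ∀ L → Inv L → ∃[ L′ ] Inv L′ × Done L′
  saturate {Inv} {Done} step L inv = go (length elements) elements ℕ.≤-refl L inv (λ x _ → complete x)
    where
    go : ∀ n R → length R ≤ n → ∀ L → Inv L → (∀ x → x ∉ L → x ∈ R) → ∃[ L′ ] Inv L′ × Done L′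
    go n R R≤n L inv rest with step L inv
    ... | inj₂ done = L , inv , done
    go zero    [] _   L inv rest | inj₁ (x , x∉L , _) with () ← rest x x∉L
    go (suc n) R  R≤n L inv rest | inj₁ (x , x∉L , inv′) =
      go n (filter (λ y → ¬? (y ≟ x)) R)
        (ℕ.≤-pred (ℕ.≤-trans (filter-notAll (λ y → ¬? (y ≟ x)) R
          (Any.map (λ { refl ¬r → ¬r refl }) (rest x x∉L))) R≤n))
        (x ∷ L) inv′
        (λ y y∉ → ∈-filter⁺ (λ y → ¬? (y ≟ x)) (rest y (y∉ ∘ there)) (y∉ ∘ here))

-- Lists as paths and cycles

module _ {A : Set} where

  -- This makes two extremal choices: the farthest neighbour of the end of a path, and the last
  -- vertex of a cycle with a neighbour off the cycle.
  last-satisfying : ∀ {P : A → Set} → Decidable P → ∀ {xs} → Any P xs →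
                    ∃[ ys ] ∃[ y ] ∃[ zs ] xs ≡ ys ++ y ∷ zs × P y × (∀ {z} → z ∈ zs → ¬ P z)
  last-satisfying P? {x ∷ xs} some with Any.any? P? xs
  ... | yes later =
    let ys , y , zs , eq , py , none = last-satisfying P? later in x ∷ ys , y , zs , cong (x ∷_) eq , py , none
  ... | no none with some
  ... | here px = [] , x , xs , refl , px , λ z∈ pz → none (lose z∈ pz)
  ... | there later = contradiction later none

  unique-++ˡ : ∀ (xs : List A) {ys} → Unique (xs ++ ys) → Unique xs
  unique-++ˡ []       _        = []
  unique-++ˡ (x ∷ xs) (x# ∷ u) = All.++⁻ˡ xs x# ∷ unique-++ˡ xs u

  module _ {R : A → A → Set} where

    linked-++ˡ : ∀ xs {ys} → Linked R (xs ++ ys) → Linked R xs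
    linked-++ˡ []           _       = []
    linked-++ˡ (x ∷ [])     _       = [-]
    linked-++ˡ (x ∷ y ∷ xs) (r ∷ l) = r ∷ linked-++ˡ (y ∷ xs) l

    linked-++ʳ : ∀ xs {ys} → Linked R (xs ++ ys) → Linked R ys
    linked-++ʳ []       l = l
    linked-++ʳ (x ∷ xs) l = linked-++ʳ xs (Linked.tail l)

    linked-snoc : ∀ xs {y z} → Linked R (xs ++ y ∷ []) → R y z → Linked R (xs ++ y ∷ z ∷ [])
    linked-snoc []            _       r′ = r′ ∷ [-]
    linked-snoc (x ∷ [])      (r ∷ l) r′ = r ∷ linked-snoc [] l r′
    linked-snoc (x ∷ w ∷ xs)  (r ∷ l) r′ = r ∷ linked-snoc (w ∷ xs) l r′

    linked-reverse : Symmetric R → ∀ {xs} → Linked R xs → Linked R (reverse xs)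
    linked-reverse symm []  = []
    linked-reverse symm [-] = [-]
    linked-reverse symm {x ∷ y ∷ xs} (r ∷ l) =
      subst (Linked R) (sym (trans (unfold-reverse x (y ∷ xs))
        (trans (cong (_++ x ∷ []) (unfold-reverse y xs)) (++-assoc (reverse xs) _ _))))
        (linked-snoc (reverse xs) (subst (Linked R) (unfold-reverse y xs) (linked-reverse symm l)) (symm r))

    Cyclic : List A → Set
    Cyclic []       = Linked R []
    Cyclic (x ∷ xs) = Linked R (x ∷ xs ++ x ∷ [])

    rotate : ∀ xs ys → Cyclic (xs ++ ys) → Cyclic (ys ++ xs)
    rotate []       ys c = subst Cyclic (sym (++-identityʳ ys)) c
    rotate (x ∷ xs) ys c = subst Cyclic (++-assoc ys (x ∷ []) xs)
      (rotate xs (ys ++ x ∷ []) (subst Cyclic (++-assoc xs ys _) (rotate₁ x (xs ++ ys) c)))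
      where
      rotate₁ : ∀ x xs → Cyclic (x ∷ xs) → Cyclic (xs ++ x ∷ [])
      rotate₁ x []       c       = c
      rotate₁ x (y ∷ xs) (r ∷ l) = subst (Linked R) (sym (cong (y ∷_) (++-assoc xs _ _))) (linked-snoc (y ∷ xs) l r)

    reverse-cycle : Symmetric R → ∀ x xs → Cyclic (x ∷ xs) → Cyclic (x ∷ reverse xs)
    reverse-cycle symm x xs c = subst (Linked R) (trans (unfold-reverse x (xs ++ x ∷ []))
      (cong (_++ x ∷ []) (reverse-++ xs (x ∷ [])))) (linked-reverse symm c)

  unique-resp-↭ : ∀ {xs ys : List A} → xs ↭ ys → Unique xs → Unique ys
  unique-resp-↭ p = ↭ₛ.Unique-resp-↭ (setoid A) (↭⇒↭ₛ p)

unique-++ʳ : ∀ {A : Set} (xs : List A) {ys} → Unique (xs ++ ys) → Unique ys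
unique-++ʳ []       u       = u
unique-++ʳ (x ∷ xs) (_ ∷ u) = unique-++ʳ xs u

unique-disjoint : ∀ {A : Set} (xs : List A) {ys x} → Unique (xs ++ ys) → x ∈ xs → x ∉ ys
unique-disjoint (x ∷ xs) (x# ∷ u) (here refl) x∈ys = All.lookup x# (∈-++⁺ʳ xs x∈ys) refl
unique-disjoint (x ∷ xs) (x# ∷ u) (there x∈)  x∈ys = unique-disjoint xs u x∈ x∈ys

module CubicGraph (H : Multigraph) (simple : IsSimple H) (cubic : IsCubic H) where

  open Multigraph H
    using (Vertex; Edge; vertices; edges; ends; loopless; Joins; Adjacent; Incident; incident?;
           _≟ᵛ_; _≟ᵉ_; vertex-finite; edge-finite)
  open import Data.List.Membership.DecPropositional _≟ᵛ_ using (_∈?_)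

  private
    variable
      r u v w x y : Vertex
      e ε : Edge

  -- Totals

  Weighting : Set
  Weighting = Edge → Fin 3

  incidences : Vertex → List Edge
  incidences v = filter (incident? v) edges

  incidences-unique : ∀ v → Unique (incidences v)
  incidences-unique v = Unique.filter⁺ (incident? v) (Finite.unique edge-finite)

  ∈-incidences : Incident v e → e ∈ incidences v
  ∈-incidences {v} {e} = ∈-filter⁺ (incident? v) (Finite.complete edge-finite e)

  incidences-∈ : e ∈ incidences v → Incident v e
  incidences-∈ {v = v} = proj₂ ∘ ∈-filter⁻ (incident? v) {xs = edges}

  total : Weighting → Vertex → ℕ
  total f v = sum (map (toℕ ∘ f) (incidences v))

  infixl 7 _⟦_≔_⟧
  _⟦_≔_⟧ : Weighting → Edge → Fin 3 → Weighting
  _⟦_≔_⟧ = _[_≔_] _≟ᵉ_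

  total-zero : ∀ v → total (λ _ → zero) v ≡ 0
  total-zero v = go (incidences v)
    where
    go : ∀ (es : List Edge) → sum (map (λ _ → toℕ {3} zero) es) ≡ 0
    go []       = refl
    go (_ ∷ es) = go es

  total-incident : ∀ f e a → Incident v e → total (f ⟦ e ≔ a ⟧) v + toℕ (f e) ≡ total f v + toℕ a
  total-incident f e a i = sum-update-∈ _≟ᵉ_ f e a _ (incidences-unique _) (∈-incidences i)

  total-non-incident : ∀ f e a → ¬ Incident v e → total (f ⟦ e ≔ a ⟧) v ≡ total f v
  total-non-incident f e a ¬i = sum-update-∉ _≟ᵉ_ f e a _ (¬i ∘ incidences-∈)

  Joins-sym : Joins e u v → Joins e v u
  Joins-sym = swap

  Joins⇒Incident : Joins e u v → Incident u e
  Joins⇒Incident (inj₁ eq) = inj₁ (sym (cong proj₁ eq))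
  Joins⇒Incident (inj₂ eq) = inj₂ (sym (cong proj₂ eq))

  Incident⇒end : Joins e u v → Incident x e → x ≡ u ⊎ x ≡ v
  Incident⇒end (inj₁ refl) i = i
  Incident⇒end (inj₂ refl) i = swap i

  Joins⇒≢ : Joins e u v → u ≢ v
  Joins⇒≢ {e = e} (inj₁ refl) = loopless e
  Joins⇒≢ {e = e} (inj₂ refl) = loopless e ∘ sym

  Joins-injective : Joins e u v → Joins e u w → v ≡ w
  Joins-injective (inj₁ refl) (inj₁ refl) = refl
  Joins-injective {e = e} (inj₁ refl) (inj₂ eq) = ⊥-elim (loopless e (sym (cong proj₂ eq)))
  Joins-injective {e = e} (inj₂ refl) (inj₁ eq) = ⊥-elim (loopless e (cong proj₁ eq))
  Joins-injective (inj₂ refl) (inj₂ refl) = refl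

  Adjacent-sym : Adjacent u v → Adjacent v u
  Adjacent-sym (e , j) = e , Joins-sym j

  Adjacent⇒≢ : Adjacent u v → u ≢ v
  Adjacent⇒≢ (e , j) = Joins⇒≢ {e} j

  total-left : ∀ f a → Joins e u v → total (f ⟦ e ≔ a ⟧) u + toℕ (f e) ≡ total f u + toℕ a
  total-left {e} f a j = total-incident f e a (Joins⇒Incident {e} j)

  total-other : ∀ f a → Joins e u v → x ≢ u → x ≢ v → total (f ⟦ e ≔ a ⟧) x ≡ total f x
  total-other {e} f a j x≢u x≢v = total-non-incident f e a
    (Sum.[ x≢u , x≢v ] ∘ Incident⇒end {e} j)

  raise-left : ∀ {f} a → Joins e u v → f e ≡ zero → total (f ⟦ e ≔ a ⟧) u ≡ total f u + toℕ a
  raise-left {e} {u = u} {f = f} a j fe≡0 = trans (sym (ℕ.+-identityʳ _))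
    (subst (λ b → total (f ⟦ e ≔ a ⟧) u + toℕ b ≡ total f u + toℕ a) fe≡0 (total-left {e} f a j))

  raise-right : ∀ {f} a → Joins e u v → f e ≡ zero → total (f ⟦ e ≔ a ⟧) v ≡ total f v + toℕ a
  raise-right {e} a j = raise-left {e} a (Joins-sym {e} j)

  incident⇒joins : Incident v e → ∃[ w ] Joins e v w
  incident⇒joins {e = e} (inj₁ refl) = proj₂ (ends e) , inj₁ refl
  incident⇒joins {e = e} (inj₂ refl) = proj₁ (ends e) , inj₂ refl

  adjacent? : ∀ u v → Dec (Adjacent u v)
  adjacent? u v = map′ (λ p → let e , _ , j = find p in e , j) (λ (e , j) → lose (Finite.complete edge-finite e) j)
    (Any.any? (λ e → joins? e) edges)
    where
    joins? : ∀ e → Dec (Joins e u v)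
    joins? e = Product.≡-dec _≟ᵛ_ _≟ᵛ_ (ends e) (u , v) ⊎-dec Product.≡-dec _≟ᵛ_ _≟ᵛ_ (ends e) (v , u)

  -- The neighbour `w` is singled out because it is usually the one that is unsettled or uncoloured,
  -- so that only `n₁` and `n₂` impose conditions on `v`. Simplicity makes the three neighbours
  -- distinct.
  record Neighbours (v w : Vertex) : Set where
    field
      {n₁ n₂}  : Vertex
      adj₁     : Adjacent v n₁
      adj₂     : Adjacent v n₂
      n₁≢w     : n₁ ≢ w
      n₂≢w     : n₂ ≢ w
      n₁≢n₂    : n₁ ≢ n₂
      complete : ∀ {x} → Adjacent v x → x ≡ w ⊎ x ≡ n₁ ⊎ x ≡ n₂

  neighbours : Adjacent v w → Neighbours v w
  neighbours {v} {w} (e , j) =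
    go (incidences v) (cubic v) (incidences-unique v) incidences-∈ ∈-incidences
    where
    build : ∀ {a b} → a ≢ b → a ≢ e → b ≢ e → Incident v a → Incident v b →
            (∀ {d} → Incident v d → d ≡ e ⊎ d ≡ a ⊎ d ≡ b) → Neighbours v w
    build {a} {b} a≢b a≢e b≢e ia ib all =
      let n₁ , j₁ = incident⇒joins {e = a} ia ; n₂ , j₂ = incident⇒joins {e = b} ib in record
      { adj₁  = a , j₁
      ; adj₂  = b , j₂
      ; n₁≢w  = λ eq → a≢e (simple {a} {e} (subst (Joins a v) eq j₁) j)
      ; n₂≢w  = λ eq → b≢e (simple {b} {e} (subst (Joins b v) eq j₂) j)
      ; n₁≢n₂ = λ eq → a≢b (simple {a} {b} (subst (Joins a v) eq j₁) j₂)
      ; complete = λ (d , k) → Sum.map (λ { refl → Joins-injective {e} k j })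
          (Sum.map (λ { refl → Joins-injective {a} k j₁ }) (λ { refl → Joins-injective {b} k j₂ }))
          (all {d} (Joins⇒Incident {d} k))
      }

    go : ∀ es → length es ≡ 3 → Unique es → (∀ {d} → d ∈ es → Incident v d) →
         (∀ {d} → Incident v d → d ∈ es) → Neighbours v w
    go (a ∷ b ∷ c ∷ []) refl ((a≢b ∷ a≢c ∷ []) ∷ (b≢c ∷ []) ∷ [] ∷ []) inc com with com {e} (Joins⇒Incident {e} j)
    ... | here refl = build b≢c (a≢b ∘ sym) (a≢c ∘ sym) (inc (there (here refl))) (inc (there (there (here refl))))
      (λ i → cases (com i))
      where cases : ∀ {d} → d ∈ a ∷ b ∷ c ∷ [] → d ≡ a ⊎ d ≡ b ⊎ d ≡ c
            cases (here p) = inj₁ p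
            cases (there (here p)) = inj₂ (inj₁ p)
            cases (there (there (here p))) = inj₂ (inj₂ p)
    ... | there (here refl) = build a≢c a≢b (b≢c ∘ sym) (inc (here refl)) (inc (there (there (here refl))))
      (λ i → cases (com i))
      where cases : ∀ {d} → d ∈ a ∷ b ∷ c ∷ [] → d ≡ b ⊎ d ≡ a ⊎ d ≡ c
            cases (here p) = inj₂ (inj₁ p)
            cases (there (here p)) = inj₁ p
            cases (there (there (here p))) = inj₂ (inj₂ p)
    ... | there (there (here refl)) = build a≢b a≢c b≢c (inc (here refl)) (inc (there (here refl)))
      (λ i → cases (com i))
      where cases : ∀ {d} → d ∈ a ∷ b ∷ c ∷ [] → d ≡ c ⊎ d ≡ a ⊎ d ≡ b
            cases (here p) = inj₂ (inj₁ p)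
            cases (there (here p)) = inj₂ (inj₂ p)
            cases (there (there (here p))) = inj₁ p

  neighbour : ∀ v → ∃[ w ] Adjacent v w
  neighbour v = go (incidences v) (cubic v) incidences-∈
    where
    go : ∀ es → length es ≡ 3 → (∀ {d} → d ∈ es → Incident v d) → ∃[ w ] Adjacent v w
    go (a ∷ _) _ inc = let w , j = incident⇒joins {e = a} (inc (here refl)) in w , a , j

  only-three : ∀ {a b c} → Adjacent v a → Adjacent v b → Adjacent v c → a ≢ b → a ≢ c → b ≢ c →
               ∀ {x} → Adjacent v x → x ≡ a ⊎ x ≡ b ⊎ x ≡ c
  only-three {v} {a} {b} {c} va vb vc a≢b a≢c b≢c {x} vx with complete vb | complete vc | complete vx
    where open Neighbours (neighbours va)
  ... | inj₁ p | _ | _ = contradiction (sym p) a≢b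
  ... | _ | inj₁ q | _ = contradiction (sym q) a≢c
  ... | _ | _ | inj₁ r = inj₁ r
  ... | inj₂ (inj₁ p) | inj₂ (inj₁ q) | _ = contradiction (trans p (sym q)) b≢c
  ... | inj₂ (inj₂ p) | inj₂ (inj₂ q) | _ = contradiction (trans p (sym q)) b≢c
  ... | inj₂ (inj₁ p) | _ | inj₂ (inj₁ r) = inj₂ (inj₁ (trans r (sym p)))
  ... | inj₂ (inj₂ p) | _ | inj₂ (inj₂ r) = inj₂ (inj₁ (trans r (sym p)))
  ... | _ | inj₂ (inj₁ q) | inj₂ (inj₁ r) = inj₂ (inj₂ (trans r (sym q)))
  ... | _ | inj₂ (inj₂ q) | inj₂ (inj₂ r) = inj₂ (inj₂ (trans r (sym q)))

  Separated : Weighting → (Vertex → Set) → Set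
  Separated f P = ∀ {u v} → P u → P v → Adjacent u v → total f u ≢ total f v

  separated-insert : ∀ {f f′ P} → Separated f P → (∀ {x} → P x → total f′ x ≡ total f x) →
                     (∀ {x} → P x → Adjacent v x → total f′ v ≢ total f x) →
                     Separated f′ (λ x → P x ⊎ x ≡ v)
  separated-insert sep same new (inj₁ pu)   (inj₁ pv)   a eq = sep pu pv a (trans (sym (same pu)) (trans eq (same pv)))
  separated-insert sep same new (inj₁ pu)   (inj₂ refl) a eq = new pu (Adjacent-sym a) (trans (sym eq) (same pu))
  separated-insert sep same new (inj₂ refl) (inj₁ pv)   a eq = new pv a (trans eq (same pv))
  separated-insert sep same new (inj₂ refl) (inj₂ refl) a eq = Adjacent⇒≢ a refl

  -- As `w` is not in `P`, only the two other neighbours of `v` forbid a total, and three weights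
  -- are available. Both ends of `e` lie outside `P`, so no settled total changes.
  settle : ∀ {f P} → Separated f P → Joins e v w → ¬ P v → ¬ P w →
           ∃[ a ] Separated (f ⟦ e ≔ a ⟧) (λ x → P x ⊎ x ≡ v)
  settle {e} {v} {w} {f} {P} sep j ¬Pv ¬Pw =
    let a , avoid₁ , avoid₂ = avoid-totals (total f v) (total f n₁ + toℕ (f e)) (total f n₂ + toℕ (f e)) in
    a , separated-insert {f′ = f ⟦ e ≔ a ⟧} sep
      (λ px → total-other {e} f a j (λ { refl → ¬Pv px }) (λ { refl → ¬Pw px }))
      λ px adj eq → let eq′ = trans (sym (total-left {e} f a j)) (cong (_+ toℕ (f e)) eq) in case complete adj of λ
        { (inj₁ refl)        → ¬Pw px
        ; (inj₂ (inj₁ refl)) → avoid₁ eq′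
        ; (inj₂ (inj₂ refl)) → avoid₂ eq′ }
    where open Neighbours (neighbours (e , j))

  -- Charges modulo 3

  data Walk : Vertex → Vertex → Set where
    []  : Walk u u
    _∷_ : Adjacent u v → Walk v w → Walk u w

  infixr 5 _∷_ _++ʷ_

  _++ʷ_ : Walk u v → Walk v w → Walk u w
  []      ++ʷ q = q
  (a ∷ p) ++ʷ q = a ∷ (p ++ʷ q)

  reverseʷ : Walk u v → Walk v u
  reverseʷ []      = []
  reverseʷ (a ∷ p) = reverseʷ p ++ʷ (Adjacent-sym a ∷ [])

  walk-closed : ∀ {P : Vertex → Set} → (∀ {u v} → P u → Adjacent u v → P v) → Walk u v → P u → P v
  walk-closed closed []      pu = pu
  walk-closed closed (a ∷ p) pu = walk-closed closed p (closed pu a)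

  component : ∀ r → ∃[ L ] (r ∈ L × (∀ {v} → v ∈ L → Walk r v)) × (∀ {u v} → u ∈ L → Adjacent u v → v ∈ L)
  component r = saturate vertex-finite step (r ∷ []) (here refl , λ { (here refl) → [] })
    where
    step : ∀ L → (r ∈ L × (∀ {v} → v ∈ L → Walk r v)) →
           (∃[ x ] x ∉ L × r ∈ x ∷ L × (∀ {v} → v ∈ x ∷ L → Walk r v)) ⊎
           (∀ {u v} → u ∈ L → Adjacent u v → v ∈ L)
    step L (r∈L , walks)
      with Any.any? (λ x → ¬? (x ∈? L) ×-dec Any.any? (λ u → adjacent? u x) L) vertices
    ... | yes some = let x , _ , x∉L , near = find some ; u , u∈L , a = find near in
      inj₁ (x , x∉L , there r∈L , λ { (here refl) → walks u∈L ++ʷ (a ∷ []) ; (there v∈) → walks v∈ })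
    ... | no none = inj₂ λ {u} {v} u∈L a → decide u∈L a (v ∈? L)
      where
      decide : ∀ {u v} → u ∈ L → Adjacent u v → Dec (v ∈ L) → v ∈ L
      decide u∈L a (yes v∈L) = v∈L
      decide u∈L a (no  v∉L) = contradiction
        (lose (Finite.complete vertex-finite _) (v∉L , lose u∈L a)) none

  walk? : ∀ r v → Dec (Walk r v)
  walk? r v = let L , (r∈L , walks) , closed = component r in
    map′ walks (λ p → walk-closed {P = _∈ L} closed p r∈L) (v ∈? L)

  charge : Weighting → Vertex → Fin 3
  charge f v = residue (total f v)

  at : Vertex → Fin 3 → Vertex → Fin 3
  at u t = _[_≔_] _≟ᵛ_ (λ _ → zero) u t

  at-≡ : ∀ u t → at u t u ≡ t
  at-≡ u t = update-≡ _≟ᵛ_ (λ _ → zero) u t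

  at-≢ : ∀ u t → x ≢ u → at u t x ≡ zero
  at-≢ u t = update-≢ _≟ᵛ_ (λ _ → zero) u t

  at-⊖ : ∀ u t x → at u t x ⊕ at u (⊖ t) x ≡ zero
  at-⊖ u t x with x ≟ᵛ u
  ... | yes _ = inverse t
    where
    inverse : ∀ t → t ⊕ (⊖ t) ≡ zero
    inverse = from-yes (all? λ t → t ⊕ (⊖ t) ≟³ zero)
  ... | no _ = refl

  -- The new weight is reduced modulo 3, so an actual total may drop; only residues are controlled.
  shift : Joins e u v → ∀ f t → ∃[ f′ ] (∀ x → charge f′ x ≡ charge f x ⊕ at u t x ⊕ at v t x)
  shift {e} {u} {v} j f t = f′ , λ x → cases x (x ≟ᵛ u) (x ≟ᵛ v)
    where
    f′ = f ⟦ e ≔ f e ⊕ t ⟧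

    end : ∀ {x} → Incident x e → charge f′ x ≡ charge f x ⊕ t
    end {x} i = ⊕-cancelʳ (f e) _ _ (begin
      charge f′ x ⊕ f e                       ≡⟨ cong (charge f′ x ⊕_) (residue-toℕ (f e)) ⟨
      charge f′ x ⊕ residue (toℕ (f e))       ≡⟨ residue-+ (total f′ x) _ ⟨
      residue (total f′ x + toℕ (f e))        ≡⟨ cong residue (total-incident f e (f e ⊕ t) i) ⟩
      residue (total f x + toℕ (f e ⊕ t))     ≡⟨ residue-+ (total f x) _ ⟩
      charge f x ⊕ residue (toℕ (f e ⊕ t))    ≡⟨ cong (charge f x ⊕_) (residue-toℕ (f e ⊕ t)) ⟩
      charge f x ⊕ (f e ⊕ t)                  ≡⟨ cong (charge f x ⊕_) (⊕-comm (f e) t) ⟩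
      charge f x ⊕ (t ⊕ f e)                  ≡⟨ ⊕-assoc (charge f x) t (f e) ⟨
      charge f x ⊕ t ⊕ f e                    ∎)
      where open ≡-Reasoning

    cases : ∀ x → Dec (x ≡ u) → Dec (x ≡ v) → charge f′ x ≡ charge f x ⊕ at u t x ⊕ at v t x
    cases x (yes refl) _ rewrite at-≡ u t | at-≢ v t (Joins⇒≢ {e} j) | ⊕-identityʳ (charge f u ⊕ t) =
      end (Joins⇒Incident {e} j)
    cases x (no x≢u) (yes refl) rewrite at-≡ v t | at-≢ u t x≢u | ⊕-identityʳ (charge f v) =
      end (Joins⇒Incident {e} (Joins-sym {e} j))
    cases x (no x≢u) (no x≢v)
      rewrite at-≢ u t x≢u | at-≢ v t x≢v | ⊕-identityʳ (charge f x) | ⊕-identityʳ (charge f x) =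
      cong residue (total-other {e} f (f e ⊕ t) j x≢u x≢v)

  odd : Walk u v → Bool
  odd []      = false
  odd (_ ∷ p) = not (odd p)

  sign : Bool → Fin 3 → Fin 3
  sign b t = if b then t else ⊖ t

  -- Alternating ±t along a walk leaves the charges of its inner vertices alone.
  push : (p : Walk u v) → ∀ f t →
         ∃[ f′ ] (∀ x → charge f′ x ≡ charge f x ⊕ at u t x ⊕ at v (sign (odd p) t) x)
  push {u} [] f t = f , λ x → sym (⊕-inverse-absorb (charge f x) _ _ (at-⊖ u t x))
  push {u} {v} (_∷_ {v = m} (e , j) p) f t =
    let f₁ , eq₁ = shift {e} j f t
        f₂ , eq₂ = push p f₁ (⊖ t)
    in f₂ , λ x → let s = sign (not (odd p)) t in begin
      charge f₂ x
        ≡⟨ eq₂ x ⟩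
      charge f₁ x ⊕ at m (⊖ t) x ⊕ at v (sign (odd p) (⊖ t)) x
        ≡⟨ cong₂ (λ a b → a ⊕ at m (⊖ t) x ⊕ at v b x) (eq₁ x) (sign-not (odd p) t) ⟩
      charge f x ⊕ at u t x ⊕ at m t x ⊕ at m (⊖ t) x ⊕ at v s x
        ≡⟨ cong (_⊕ at v s x) (⊕-inverse-absorb (charge f x ⊕ at u t x) _ _ (at-⊖ m t x)) ⟩
      charge f x ⊕ at u t x ⊕ at v s x ∎
    where
    open ≡-Reasoning
    sign-not : ∀ b t → sign b (⊖ t) ≡ sign (not b) t
    sign-not false = from-yes (all? λ t → ⊖ (⊖ t) ≟³ t)
    sign-not true  t = refl

  -- Each vertex is corrected by a push from `r`, which affects no charge except those of `r` and of
  -- that vertex. Earlier corrections survive, and the whole error collects at `r`.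
  realise : ∀ (c : Vertex → Fin 3) r → ∃[ f ] (∀ {v} → Walk r v → v ≢ r → charge f v ≡ c v)
  realise c r = let f , eq = go vertices in f , eq (Finite.complete vertex-finite _)
    where
    go : ∀ vs → ∃[ f ] (∀ {v} → v ∈ vs → Walk r v → v ≢ r → charge f v ≡ c v)
    go [] = (λ _ → zero) , λ ()
    go (x ∷ vs) with go vs | x ≟ᵛ r | walk? r x
    ... | f , eq | yes refl | _    = f , λ { (here refl) _ v≢r → contradiction refl v≢r ; (there v∈) → eq v∈ }
    ... | f , eq | no _ | no ¬p    = f , λ { (here refl) p → contradiction p ¬p ; (there v∈) → eq v∈ }
    ... | f , eq | no x≢r | yes p  = f′ , λ {v} v∈ q v≢r → cases v v∈ q v≢r (v ≟ᵛ x)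
      where
      solve : ∀ b a c → ∃[ t ] a ⊕ sign b t ≡ c
      solve false = from-yes (all? λ a → all? λ c → any? λ t → a ⊕ ⊖ t ≟³ c)
      solve true  = from-yes (all? λ a → all? λ c → any? λ t → a ⊕ t ≟³ c)

      t  = proj₁ (solve (odd p) (charge f x) (c x))
      f′ = proj₁ (push p f t)

      cases : ∀ v → v ∈ x ∷ vs → Walk r v → v ≢ r → Dec (v ≡ x) → charge f′ v ≡ c v
      cases v _ q v≢r (yes refl) = begin
        charge f′ v                                            ≡⟨ proj₂ (push p f t) v ⟩
        charge f v ⊕ at r t v ⊕ at v (sign (odd p) t) v        ≡⟨ cong₂ _⊕_ (cong (charge f v ⊕_) (at-≢ r t v≢r)) (at-≡ v _) ⟩
        charge f v ⊕ zero ⊕ sign (odd p) t                     ≡⟨ cong (_⊕ sign (odd p) t) (⊕-identityʳ (charge f v)) ⟩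
        charge f v ⊕ sign (odd p) t                            ≡⟨ proj₂ (solve (odd p) (charge f v) (c v)) ⟩
        c v                                                    ∎
        where open ≡-Reasoning
      cases v (here v≡x) q v≢r (no v≢x) = contradiction v≡x v≢x
      cases v (there v∈) q v≢r (no v≢x) = begin
        charge f′ v                                            ≡⟨ proj₂ (push p f t) v ⟩
        charge f v ⊕ at r t v ⊕ at x (sign (odd p) t) v        ≡⟨ cong₂ _⊕_ (cong (charge f v ⊕_) (at-≢ r t v≢r)) (at-≢ x _ v≢x) ⟩
        charge f v ⊕ zero ⊕ zero                               ≡⟨ trans (⊕-identityʳ _) (⊕-identityʳ (charge f v)) ⟩
        charge f v                                             ≡⟨ eq v∈ q v≢r ⟩
        c v                                                    ∎
        where open ≡-Reasoning

  Proper : Vertex → {A : Set} → (Vertex → A) → Set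
  Proper r c = ∀ {u v} → Walk r u → Adjacent u v → c u ≢ c v

  charge-proper : ∀ {f} → Proper r (charge f) → Proper r (total f)
  charge-proper proper p a eq = proper p a (cong residue eq)

  Proper-cong : ∀ {A : Set} {c d : Vertex → A} → (∀ {v} → Walk r v → d v ≡ c v) → Proper r c → Proper r d
  Proper-cong d≡c proper p a eq =
    proper p a (trans (sym (d≡c p)) (trans eq (d≡c (p ++ʷ (a ∷ [])))))

  -- The walks `p` and `q` and the edge between their ends form a closed walk of odd length through
  -- `r`. Alternating around it changes only the charge of `r`, by `2t`, and 2 is invertible modulo
  -- 3.
  nonbipartite : ∀ {c : Vertex → Fin 3} → Proper r c →
                 (p : Walk r u) → Adjacent u v → (q : Walk r v) → odd p ≡ odd q →
                 ∃[ f ] Proper r (total f)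
  nonbipartite {r} {u} {v} {c} proper p (e , j) q same =
    f₃ , charge-proper (Proper-cong realised proper)
    where
    open ≡-Reasoning
    solve : ∀ a b → ∃[ t ] a ⊕ t ⊕ t ≡ b
    solve = from-yes (all? λ a → all? λ b → any? λ t → a ⊕ t ⊕ t ≟³ b)

    f₀ = proj₁ (realise c r)
    t  = proj₁ (solve (charge f₀ r) (c r))
    s  = sign (odd p) t
    f₁ = proj₁ (push p f₀ t)
    -- This cancels the charge `s` that the push along `p` left at `u`. It puts the negative of `s`
    -- at `v`, where the push along `q` cancels it because the parities agree.
    f₂ = proj₁ (shift {e} j f₁ (⊖ s))
    f₃ = proj₁ (push q f₂ t)

    telescope : ∀ a b x y x′ y′ → x ⊕ x′ ≡ zero → y ⊕ y′ ≡ zero →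
                a ⊕ b ⊕ x ⊕ x′ ⊕ y′ ⊕ b ⊕ y ≡ a ⊕ b ⊕ b
    telescope a b x y x′ y′ p q = begin
      a ⊕ b ⊕ x ⊕ x′ ⊕ y′ ⊕ b ⊕ y     ≡⟨ cong (λ z → z ⊕ y′ ⊕ b ⊕ y) (⊕-inverse-absorb (a ⊕ b) x x′ p) ⟩
      a ⊕ b ⊕ y′ ⊕ b ⊕ y              ≡⟨ ⊕-assoc (a ⊕ b ⊕ y′) b y ⟩
      a ⊕ b ⊕ y′ ⊕ (b ⊕ y)            ≡⟨ cong (a ⊕ b ⊕ y′ ⊕_) (⊕-comm b y) ⟩
      a ⊕ b ⊕ y′ ⊕ (y ⊕ b)            ≡⟨ ⊕-assoc (a ⊕ b ⊕ y′) y b ⟨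
      a ⊕ b ⊕ y′ ⊕ y ⊕ b              ≡⟨ cong (_⊕ b) (⊕-inverse-absorb (a ⊕ b) y′ y (trans (⊕-comm y′ y) q)) ⟩
      a ⊕ b ⊕ b                       ∎

    charge₃ : ∀ x → charge f₃ x ≡ charge f₀ x ⊕ at r t x ⊕ at r t x
    charge₃ x = begin
      charge f₃ x
        ≡⟨ proj₂ (push q f₂ t) x ⟩
      charge f₂ x ⊕ at r t x ⊕ at v (sign (odd q) t) x
        ≡⟨ cong (λ b → charge f₂ x ⊕ at r t x ⊕ at v (sign b t) x) same ⟨
      charge f₂ x ⊕ at r t x ⊕ at v s x
        ≡⟨ cong (λ z → z ⊕ at r t x ⊕ at v s x) (trans (proj₂ (shift {e} j f₁ (⊖ s)) x)
             (cong (λ z → z ⊕ at u (⊖ s) x ⊕ at v (⊖ s) x) (proj₂ (push p f₀ t) x))) ⟩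
      charge f₀ x ⊕ at r t x ⊕ at u s x ⊕ at u (⊖ s) x ⊕ at v (⊖ s) x ⊕ at r t x ⊕ at v s x
        ≡⟨ telescope (charge f₀ x) (at r t x) _ _ _ _ (at-⊖ u s x) (at-⊖ v s x) ⟩
      charge f₀ x ⊕ at r t x ⊕ at r t x ∎

    realised : ∀ {x} → Walk r x → charge f₃ x ≡ c x
    realised {x} w with x ≟ᵛ r
    ... | yes refl = trans (charge₃ x) (trans (cong (λ z → charge f₀ x ⊕ z ⊕ z) (at-≡ r t)) (proj₂ (solve (charge f₀ r) (c r))))
    ... | no x≢r   = trans (charge₃ x) (trans (cong (λ z → charge f₀ x ⊕ z ⊕ z) (at-≢ r t x≢r))
      (trans (trans (⊕-identityʳ _) (⊕-identityʳ (charge f₀ x))) (proj₂ (realise c r) w x≢r)))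


  -- The side of `r` needs only nonzero residues against 0 on the other side, so the uncontrolled
  -- charge of `r` does harm only if it is 0.
  bipartite : ∀ {side : Vertex → Bool} → Proper r side → ∃[ f ] Proper r (total f)
  bipartite {r} {side} alternates = finish (charge f₀ r ≟³ zero)
    where
    f₀ = proj₁ (realise colour r)
      where
      colour : Vertex → Fin 3
      colour v = if does (side v Bool.≟ side r) then suc zero else zero

    colour-same : v ≢ r → Walk r v → side v ≡ side r → charge f₀ v ≡ suc zero
    colour-same {v} v≢r p eq = trans (proj₂ (realise _ r) p v≢r)
      (cong (if_then suc zero else zero) (dec-true (side v Bool.≟ side r) eq))

    colour-different : Walk r v → side v ≢ side r → charge f₀ v ≡ zero
    colour-different {v} p ne = trans (proj₂ (realise _ r) p (λ { refl → ne refl }))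
      (cong (if_then suc zero else zero) (dec-false (side v Bool.≟ side r) ne))

    TwoSided : Weighting → Set
    TwoSided f = (∀ {v} → Walk r v → side v ≡ side r → charge f v ≢ zero) ×
                  (∀ {v} → Walk r v → side v ≢ side r → charge f v ≡ zero)

    two-sided : ∀ {f} → TwoSided f → Proper r (total f)
    two-sided {f} (nonzero , zeros) = charge-proper λ {u} {v} p a eq →
      let q = p ++ʷ (a ∷ []) in
      cases p q (alternates p a) eq (side u Bool.≟ side r) (side v Bool.≟ side r)
      where
      cases : ∀ {u v} → Walk r u → Walk r v → side u ≢ side v → charge f u ≡ charge f v →
              Dec (side u ≡ side r) → Dec (side v ≡ side r) → ⊥
      cases p q ne eq (yes su) (yes sv) = ne (trans su (sym sv))
      cases p q ne eq (yes su) (no  sv) = nonzero p su (trans eq (zeros q sv))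
      cases p q ne eq (no  su) (yes sv) = nonzero q sv (trans (sym eq) (zeros p su))
      cases p q ne eq (no  su) (no  sv) = ne (trans (Bool.¬-not su) (sym (Bool.¬-not sv)))

    finish : Dec (charge f₀ r ≡ zero) → ∃[ f ] Proper r (total f)
    finish (no r≢0) = f₀ , two-sided {f₀}
      ( (λ {v} p same → nonzero p same (v ≟ᵛ r))
      , colour-different )
      where
      nonzero : Walk r v → side v ≡ side r → Dec (v ≡ r) → charge f₀ v ≢ zero
      nonzero p same (yes refl) = r≢0
      nonzero p same (no v≢r)   = λ eq → case trans (sym (colour-same v≢r p same)) eq of λ ()
    finish (yes r≡0) = f₁ , two-sided {f₁} (nonzero , zeros)
      where
      b   = proj₁ (neighbour r)
      r~b = proj₂ (neighbour r)
      open Neighbours (neighbours {b} {r} (Adjacent-sym r~b)) renaming (n₁ to a; adj₁ to b~a; n₁≢w to a≢r) using ()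
      -- Along this walk of length two the push adds 2 at `r` and 1 at `a`, which is on the side of
      -- `r`. Their charges 0 and 1 both become 2.
      f₁  = proj₁ (push (r~b ∷ b~a ∷ []) f₀ (suc (suc zero)))

      a-same : side a ≡ side r
      a-same = trans (sym (Bool.not-involutive (side a)))
        (trans (cong not (sym (Bool.¬-not (alternates (r~b ∷ []) b~a))))
               (sym (Bool.¬-not (alternates [] r~b))))

      eq₁ : ∀ x → charge f₁ x ≡ charge f₀ x ⊕ at r (suc (suc zero)) x ⊕ at a (suc zero) x
      eq₁ = proj₂ (push (r~b ∷ b~a ∷ []) f₀ (suc (suc zero)))

      unchanged : v ≢ r → v ≢ a → charge f₁ v ≡ charge f₀ v
      unchanged {v} v≢r v≢a = trans (eq₁ v) (trans (cong₂ (λ s t → charge f₀ v ⊕ s ⊕ t) (at-≢ r _ v≢r) (at-≢ a _ v≢a))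
        (trans (⊕-identityʳ _) (⊕-identityʳ (charge f₀ v))))

      at-r : charge f₁ r ≡ suc (suc zero)
      at-r = trans (eq₁ r) (trans (cong₂ (λ s t → charge f₀ r ⊕ s ⊕ t) (at-≡ r _) (at-≢ a _ (a≢r ∘ sym)))
        (cong (λ z → z ⊕ suc (suc zero) ⊕ zero) r≡0))

      at-a : charge f₁ a ≡ suc (suc zero)
      at-a = trans (eq₁ a) (trans (cong₂ (λ s t → charge f₀ a ⊕ s ⊕ t) (at-≢ r _ a≢r) (at-≡ a _))
        (cong (λ z → z ⊕ zero ⊕ suc zero) (colour-same a≢r (r~b ∷ b~a ∷ []) a-same)))

      nonzero : Walk r v → side v ≡ side r → charge f₁ v ≢ zero
      nonzero {v} p same eq with v ≟ᵛ r | v ≟ᵛ a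
      ... | yes refl | _        = case trans (sym at-r) eq of λ ()
      ... | no _     | yes refl = case trans (sym at-a) eq of λ ()
      ... | no v≢r   | no v≢a   =
        case trans (sym (colour-same v≢r p same)) (trans (sym (unchanged v≢r v≢a)) eq) of λ ()

      zeros : Walk r v → side v ≢ side r → charge f₁ v ≡ zero
      zeros p ne = trans (unchanged (λ { refl → ne refl }) (λ { refl → ne a-same })) (colour-different p ne)

  -- The parity of one chosen walk to each vertex is a tentative bipartition. An edge inside one of
  -- its sides closes an odd walk; if there is no such edge, the bipartition is genuine.
  from-colouring : ∀ {c : Vertex → Fin 3} → Proper r c → ∃[ f ] Proper r (total f)
  from-colouring {r} proper = decide (Any.any? same? vertices)
    where
    parity : ∀ {v} → Dec (Walk r v) → Bool
    parity (yes p) = odd p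
    -- An arbitrary value: only vertices reachable from `r` are ever compared.
    parity (no  _) = false

    side : Vertex → Bool
    side v = parity (walk? r v)

    Same : Vertex → Set
    Same u = Walk r u × Any (λ v → Adjacent u v × side u ≡ side v) vertices

    same? : ∀ u → Dec (Same u)
    same? u = walk? r u ×-dec Any.any? (λ v → adjacent? u v ×-dec (side u Bool.≟ side v)) vertices

    parity-walk : ∀ {v} (d : Dec (Walk r v)) → Walk r v → ∃[ p ] odd {r} {v} p ≡ parity d
    parity-walk (yes p) _ = p , refl
    parity-walk (no ¬p) p = contradiction p ¬p

    decide : Dec (Any Same vertices) → ∃[ f ] Proper r (total f)
    decide (yes some) =
      let u , _ , p , near = find some
          v , _ , a , same = find near
          p′ , eq  = parity-walk (walk? r u) p
          q′ , eq′ = parity-walk (walk? r v) (p ++ʷ (a ∷ []))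
      in nonbipartite proper p′ a q′ (trans eq (trans same (sym eq′)))
    decide (no none) = bipartite λ {u} {v} p a same →
      none (lose (Finite.complete vertex-finite u) (p , lose (Finite.complete vertex-finite v) (a , same)))

  -- Greedy 3-colouring

  PartialColouring : Set
  PartialColouring = Vertex → Maybe (Fin 3)

  IsProper : PartialColouring → Set
  IsProper c = ∀ {u v a} → Adjacent u v → c u ≡ just a → c v ≢ just a

  Coloured : PartialColouring → Vertex → Set
  Coloured c v = ∃[ a ] c v ≡ just a

  coloured? : ∀ c v → Coloured c v ⊎ c v ≡ nothing
  coloured? c v with c v
  ... | just a  = inj₁ (a , refl)
  ... | nothing = inj₂ refl

  uncoloured : ∀ {c v} → c v ≡ nothing → ¬ Coloured c v
  uncoloured eq (a , eq′) = case trans (sym eq) eq′ of λ ()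

  infixl 7 _⟪_≔_⟫
  _⟪_≔_⟫ : PartialColouring → Vertex → Maybe (Fin 3) → PartialColouring
  _⟪_≔_⟫ = _[_≔_] _≟ᵛ_

  colour-proper : ∀ {c} v a → IsProper c → (∀ {x} → Adjacent v x → c x ≢ just a) → IsProper (c ⟪ v ≔ just a ⟫)
  colour-proper {c} v a proper free {x} {y} adj eq eq′ with x ≟ᵛ v | y ≟ᵛ v
  ... | yes refl | yes refl = Adjacent⇒≢ adj refl
  ... | yes refl | no  _    = free adj (trans eq′ (sym eq))
  ... | no  _    | yes refl = free (Adjacent-sym adj) (trans eq (sym eq′))
  ... | no  _    | no  _    = proper adj eq eq′

  erase-proper : ∀ {c} v → IsProper c → IsProper (c ⟪ v ≔ nothing ⟫)
  erase-proper {c} v proper {x} {y} adj eq eq′ with x ≟ᵛ v | y ≟ᵛ v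
  ... | no  _    | no  _    = proper adj eq eq′

  colour-coloured : ∀ {c} v a → Coloured c x → Coloured (c ⟪ v ≔ just a ⟫) x
  colour-coloured {x} {c} v a p with x ≟ᵛ v
  ... | yes _ = a , refl
  ... | no  _ = p

  -- With `w` uncoloured, at most two colours occur around `v`. An uncoloured `n₁` or `n₂` counts as
  -- `zero`, which at worst forbids a colour needlessly.
  extend : ∀ {c} → IsProper c → Adjacent v w → c w ≡ nothing → ∃[ a ] IsProper (c ⟪ v ≔ just a ⟫)
  extend {v} {w} {c} proper a w-free =
    let b , b≢₁ , b≢₂ = avoid₂ (fromMaybe zero (c n₁)) (fromMaybe zero (c n₂))
    in b , colour-proper v b proper λ adj eq → case complete adj of λ
      { (inj₁ refl)        → case trans (sym w-free) eq of λ ()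
      ; (inj₂ (inj₁ refl)) → b≢₁ (sym (cong (fromMaybe zero) eq))
      ; (inj₂ (inj₂ refl)) → b≢₂ (sym (cong (fromMaybe zero) eq)) }
    where open Neighbours (neighbours a)

  module Avoiding (C : List Vertex) where

    record State (c : PartialColouring) : Set where
      constructor state
      field
        proper : IsProper c
        avoids : ∀ {x} → x ∈ C → c x ≡ nothing

    -- The uncoloured vertex v moves along the walk until it is next to
    -- another uncoloured vertex, where it can be coloured.
    absorb : ∀ {c t} → Walk v t → t ∈ C → State c → v ∉ C → c v ≡ nothing →
             ∃[ c′ ] State c′ × Coloured c′ v × (∀ {x} → Coloured c x → Coloured c′ x)
    absorb [] t∈C _ v∉C _ = contradiction t∈C v∉C
    absorb {v} {c} (_∷_ {v = w} a p) t∈C (state proper avoids) v∉C v-free with coloured? c w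
    ... | inj₂ w-free =
      let b , proper′ = extend proper a w-free in
      c ⟪ v ≔ just b ⟫ ,
      state proper′ (λ x∈C → trans (update-≢ _≟ᵛ_ c v _ (λ { refl → v∉C x∈C })) (avoids x∈C)) ,
      (b , update-≡ _≟ᵛ_ c v _) , colour-coloured v b
    ... | inj₁ w-col =
      let c₁ = c ⟪ w ≔ nothing ⟫
          b , proper₂ = extend (erase-proper w proper) a (update-≡ _≟ᵛ_ c w nothing)
          c₂ = c₁ ⟪ v ≔ just b ⟫
          c₃ , state₃ , w-col₃ , mono = absorb {c = c₂} p t∈C
            (state proper₂ λ {x} x∈C → trans (update-≢ _≟ᵛ_ c₁ v _ (λ { refl → v∉C x∈C }))
              (trans (update-≢ _≟ᵛ_ c w _ (λ { refl → w∉C x∈C })) (avoids x∈C)))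
            w∉C (trans (update-≢ _≟ᵛ_ c₁ v _ (Adjacent⇒≢ a ∘ sym)) (update-≡ _≟ᵛ_ c w nothing))
      in c₃ , state₃ , mono (b , update-≡ _≟ᵛ_ c₁ v _) , λ {x} x-col → old c₃ w-col₃ mono x x-col (x ≟ᵛ w)
      where
      w∉C : w ∉ C
      w∉C w∈C = uncoloured {c} (avoids w∈C) w-col

      old : ∀ c₃ {b} → Coloured c₃ w →
            (∀ {x} → Coloured (c ⟪ w ≔ nothing ⟫ ⟪ v ≔ just b ⟫) x → Coloured c₃ x) →
            ∀ x → Coloured c x → Dec (x ≡ w) → Coloured c₃ x
      old c₃ w-col₃ mono x x-col (yes refl) = w-col₃
      old c₃ {b} w-col₃ mono x (d , eq) (no x≢w) =
        mono (colour-coloured v b (d , trans (update-≢ _≟ᵛ_ c w nothing x≢w) eq))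

    -- Since `C` is never coloured, a hole that moves towards `t` must meet an uncoloured vertex on
    -- its way. Each absorption keeps coloured vertices coloured, though perhaps differently.
    colour-outside : ∀ {r t} → Walk r t → t ∈ C →
                     ∃[ c ] State c × (∀ {v} → Walk r v → v ∉ C → Coloured c v)
    colour-outside {r} p t∈C =
      let c , st , col = go vertices in c , st , col (Finite.complete vertex-finite _)
      where
      go : ∀ vs → ∃[ c ] State c × (∀ {v} → v ∈ vs → Walk r v → v ∉ C → Coloured c v)
      go [] = (λ _ → nothing) , state (λ _ ()) (λ _ → refl) , λ ()
      go (x ∷ vs) with go vs | x ∈? C | walk? r x
      ... | c , st , col | yes x∈C | _ = c , st ,
        λ { (here refl) _ x∉C → contradiction x∈C x∉C ; (there v∈) → col v∈ }
      ... | c , st , col | no _ | no ¬q = c , st ,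
        λ { (here refl) q → contradiction q ¬q ; (there v∈) → col v∈ }
      ... | c , st , col | no x∉C | yes q with coloured? c x
      ... | inj₁ x-col = c , st , λ { (here refl) _ _ → x-col ; (there v∈) → col v∈ }
      ... | inj₂ x-free =
        let c′ , st′ , x-col , mono = absorb (reverseʷ q ++ʷ p) t∈C st x∉C x-free in
        c′ , st′ , λ { (here refl) _ _ → x-col ; (there v∈) q v∉C → mono (col v∈ q v∉C) }

  -- Every vertex of `ys` is coloured while its successor is still uncoloured. The last vertex `x`
  -- has no successor here and is left to the caller.
  colour-path : ∀ ys {x c} → Linked Adjacent (ys ++ x ∷ []) → Unique (ys ++ x ∷ []) → IsProper c →
                (∀ {y} → y ∈ ys ++ x ∷ [] → c y ≡ nothing) →
                ∃[ c′ ] IsProper c′ × (∀ {y} → y ∈ ys → Coloured c′ y) × (∀ {z} → z ∉ ys → c′ z ≡ c z)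
  colour-path [] {c = c} _ _ proper _ = c , proper , (λ ()) , λ _ → refl
  colour-path (y ∷ ys) {x} {c} l (y# ∷ u) proper free =
    let n , a , n∈ = successor ys l
        b , proper′ = extend proper a (free (there n∈))
        c′ , proper″ , col , same = colour-path ys {c = c ⟪ y ≔ just b ⟫} (Linked.tail l) u proper′
          (λ z∈ → trans (update-≢ _≟ᵛ_ c y _ (All.lookup y# z∈ ∘ sym)) (free (there z∈)))
    in c′ , proper″ ,
       (λ { (here refl) → b , trans (same (λ y∈ → All.lookup y# (∈-++⁺ˡ y∈) refl)) (update-≡ _≟ᵛ_ c y _)
          ; (there z∈)  → col z∈ }) ,
       λ z∉ → trans (same (z∉ ∘ there)) (update-≢ _≟ᵛ_ c y _ (z∉ ∘ here))
    where
    successor : ∀ ys → Linked Adjacent (y ∷ ys ++ x ∷ []) → ∃[ n ] Adjacent y n × n ∈ ys ++ x ∷ []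
    successor []      (a ∷ _) = _ , a , here refl
    successor (_ ∷ _) (a ∷ _) = _ , a , here refl

  -- Both q and u, the neighbour of x off the cycle, get the same colour, so
  -- that a colour is left for x, the last vertex of the cycle.
  colour-cycle : ∀ {r q ys x u} → let C = q ∷ ys ++ x ∷ [] in
                 Walk r x → Linked Adjacent C → Unique C → Adjacent x q →
                 (∀ {y} → Adjacent q y → y ∈ C) → Adjacent x u → u ∉ C →
                 ∃[ c ] Proper r {Fin 3} c
  colour-cycle {r} {q} {ys} {x} {u} p l (q# ∷ uni) x~q inside x~u u∉C =
    (λ v → fromMaybe zero (c₃ v)) , λ {v} {w} p a → proper-on (coloured p) (coloured (p ++ʷ (a ∷ []))) a
    where
    C = q ∷ ys ++ x ∷ []
    open Avoiding C
    x∈tail : x ∈ ys ++ x ∷ []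
    x∈tail = ∈-++⁺ʳ ys (here refl)

    outside = colour-outside p (there x∈tail)
    c₀ = proj₁ outside
    open State (proj₁ (proj₂ outside))
    u-coloured = proj₂ (proj₂ outside) (p ++ʷ (x~u ∷ [])) u∉C
    a = proj₁ u-coloured
    -- All neighbours of `q` lie in `C` and are uncoloured at this point, so the colour of `u` is
    -- free for `q`.
    c₁ = c₀ ⟪ q ≔ just a ⟫

    path = colour-path ys {x} {c₁} (Linked.tail l) uni
      (colour-proper q a proper (λ adj eq → uncoloured {c₀} (avoids (inside adj)) (a , eq)))
      (λ y∈ → trans (update-≢ _≟ᵛ_ c₀ q _ (All.lookup q# y∈ ∘ sym)) (avoids (there y∈)))
    c₂ = proj₁ path
    same : ∀ {z} → z ∉ ys → c₂ z ≡ c₁ z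
    same = proj₂ (proj₂ (proj₂ path))

    q-colour : c₂ q ≡ just a
    q-colour = trans (same (λ q∈ → All.lookup q# (∈-++⁺ˡ q∈) refl)) (update-≡ _≟ᵛ_ c₀ q _)

    u-colour : c₂ u ≡ just a
    u-colour = trans (same (u∉C ∘ there ∘ ∈-++⁺ˡ))
      (trans (update-≢ _≟ᵛ_ c₀ q _ (u∉C ∘ here)) (proj₂ u-coloured))

    free : ∃[ b ] (∀ {y} → Adjacent x y → c₂ y ≢ just b)
    free with Neighbours.complete (neighbours x~q) x~u
    ... | inj₁ refl = contradiction (here refl) u∉C
    ... | inj₂ (inj₁ refl) =
      let b , b≢a , b≢n = avoid₂ a (fromMaybe zero (c₂ (Neighbours.n₂ (neighbours x~q)))) in
      b , λ adj eq → case Neighbours.complete (neighbours x~q) adj of λ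
        { (inj₁ refl)        → b≢a (just-injective (trans (sym eq) q-colour))
        ; (inj₂ (inj₁ refl)) → b≢a (just-injective (trans (sym eq) u-colour))
        ; (inj₂ (inj₂ refl)) → b≢n (sym (cong (fromMaybe zero) eq)) }
    ... | inj₂ (inj₂ refl) =
      let b , b≢a , b≢n = avoid₂ a (fromMaybe zero (c₂ (Neighbours.n₁ (neighbours x~q)))) in
      b , λ adj eq → case Neighbours.complete (neighbours x~q) adj of λ
        { (inj₁ refl)        → b≢a (just-injective (trans (sym eq) q-colour))
        ; (inj₂ (inj₂ refl)) → b≢a (just-injective (trans (sym eq) u-colour))
        ; (inj₂ (inj₁ refl)) → b≢n (sym (cong (fromMaybe zero) eq)) }

    c₃ = c₂ ⟪ x ≔ just (proj₁ free) ⟫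

    proper₃ : IsProper c₃
    proper₃ = colour-proper x (proj₁ free) (proj₁ (proj₂ path)) (proj₂ free)

    coloured : ∀ {v} → Walk r v → Coloured c₃ v
    coloured {v} p with v ∈? C
    ... | no v∉C = colour-coloured x _
      (let d , eq = proj₂ (proj₂ outside) p v∉C in
       d , trans (same (v∉C ∘ there ∘ ∈-++⁺ˡ)) (trans (update-≢ _≟ᵛ_ c₀ q _ (v∉C ∘ here)) eq))
    ... | yes (here refl) = colour-coloured x _ (a , q-colour)
    ... | yes (there v∈) with ∈-++⁻ ys v∈
    ... | inj₁ v∈ys        = colour-coloured x _ (proj₁ (proj₂ (proj₂ path)) v∈ys)
    ... | inj₂ (here refl) = proj₁ free , update-≡ _≟ᵛ_ c₂ x _

    proper-on : ∀ {v w} → Coloured c₃ v → Coloured c₃ w → Adjacent v w →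
                fromMaybe zero (c₃ v) ≢ fromMaybe zero (c₃ w)
    proper-on {v} {w} (d , eq) (d′ , eq′) a d≡d′ = proper₃ a eq (trans eq′ (cong just
      (trans (sym (cong (fromMaybe zero) eq′)) (trans (sym d≡d′) (cong (fromMaybe zero) eq)))))

  -- Cycles

  record EndCycle (r : Vertex) : Set where
    field
      {h t}     : Vertex
      ys        : List Vertex
    C : List Vertex
    C = h ∷ ys ++ t ∷ []
    field
      unique    : Unique C
      cyclic    : Cyclic {R = Adjacent} C
      h~t       : Adjacent h t
      inside    : ∀ {x} → Adjacent h x → x ∈ C
      reachable : Walk r h

  -- Paths grow at their head, so maximality puts all neighbours of `h` on the path. Cutting it
  -- behind the last of them keeps them all, and that last neighbour closes the cycle.
  end-cycle : ∀ r → EndCycle r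
  end-cycle r = build (saturate vertex-finite step (r ∷ []) (r , [] , refl , [] ∷ [] , [-] , []))
    where
    tail-∈ : ∀ {h x t} → h ≢ x → x ∈ h ∷ t → x ∈ t
    tail-∈ h≢x (here refl) = contradiction refl h≢x
    tail-∈ h≢x (there x∈t) = x∈t

    Path : List Vertex → Set
    Path L = ∃[ h ] ∃[ t ] L ≡ h ∷ t × Unique L × Linked Adjacent L × Walk r h

    Maximal : List Vertex → Set
    Maximal L = ∀ {h t x} → L ≡ h ∷ t → Adjacent h x → x ∈ L

    step : ∀ L → Path L → (∃[ x ] x ∉ L × Path (x ∷ L)) ⊎ Maximal L
    step L (h , t , refl , uni , l , p)
      with Any.any? (λ x → ¬? (x ∈? L) ×-dec adjacent? h x) vertices
    ... | yes some = let x , _ , x∉L , adj = find some in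
      inj₁ (x , x∉L , x , L , refl , All.tabulate (λ { z∈ refl → x∉L z∈ }) ∷ uni , Adjacent-sym adj ∷ l , p ++ʷ (adj ∷ []))
    ... | no none = inj₂ λ { {x = x} refl adj → case x ∈? L of λ
      { (yes x∈L) → x∈L
      ; (no  x∉L) → contradiction (lose (Finite.complete vertex-finite x) (x∉L , adj)) none } }

    build : ∃[ L ] Path L × Maximal L → EndCycle r
    build (_ , (h , t , refl , uni , l , p) , maximal) = cut (last-satisfying (adjacent? h) near)
      where
      in-tail : ∀ {x} → Adjacent h x → x ∈ t
      in-tail adj = tail-∈ (Adjacent⇒≢ adj) (maximal refl adj)

      near : Any (Adjacent h) t
      near = let x , h~x = neighbour h in lose (in-tail h~x) h~x

      cut : (∃[ ys ] ∃[ y ] ∃[ zs ] t ≡ ys ++ y ∷ zs × Adjacent h y × (∀ {z} → z ∈ zs → ¬ Adjacent h z)) → EndCycle r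
      cut (ys , y , zs , eq , h~y , none) = record
        { ys        = ys
        ; unique    = unique-++ˡ C (subst Unique split uni)
        ; cyclic    = subst (Linked Adjacent) (sym (cong (h ∷_) (++-assoc ys (y ∷ []) (h ∷ []))))
                        (linked-snoc (h ∷ ys) (linked-++ˡ C (subst (Linked Adjacent) split l)) (Adjacent-sym h~y))
        ; h~t       = h~y
        ; inside    = inside
        ; reachable = p
        }
        where
        C = h ∷ ys ++ y ∷ []

        split : h ∷ t ≡ C ++ zs
        split = cong (h ∷_) (trans eq (sym (++-assoc ys (y ∷ []) zs)))

        inside : ∀ {x} → Adjacent h x → x ∈ C
        inside {x} adj with ∈-++⁻ C (subst (x ∈_) split (there (in-tail adj)))
        ... | inj₁ x∈C  = x∈C
        ... | inj₂ x∈zs = contradiction adj (none x∈zs)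

  Outside : List Vertex → Vertex → Set
  Outside C x = Any (λ u → Adjacent x u × u ∉ C) vertices

  outside? : ∀ C → Decidable (Outside C)
  outside? C x = Any.any? (λ u → adjacent? x u ×-dec ¬? (u ∈? C)) vertices

  inside-if : ∀ {C x} → ¬ Outside C x → ∀ {u} → Adjacent x u → u ∈ C
  inside-if {C} none {u} adj with u ∈? C
  ... | yes u∈C = u∈C
  ... | no  u∉C = contradiction (lose (Finite.complete vertex-finite u) (adj , u∉C)) none

  -- The cycle is traversed from just behind its last vertex x with a
  -- neighbour outside, so that the first vertex has none.
  colour-open-cycle : ∀ {r} (E : EndCycle r) → let open EndCycle E in
                      Any (Outside C) C → ∃[ c ] Proper r {Fin 3} c
  colour-open-cycle {r} E (here out) =
    let open EndCycle E ; _ , _ , adj , u∉C = find out in contradiction (inside adj) u∉C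
  colour-open-cycle {r} E (there out) with last-satisfying (outside? (EndCycle.C E)) out
  ... | A , x , zs , eq , x-out , none =
    let u , _ , x~u , u∉C = find x-out in
    go zs R↭C (rotate (h ∷ A ++ x ∷ []) zs (subst Cyclic split cyclic)) none x~u u∉C
    where
    open EndCycle E
    split : C ≡ (h ∷ A ++ x ∷ []) ++ zs
    split = cong (h ∷_) (trans eq (sym (++-assoc A (x ∷ []) zs)))

    R↭C : zs ++ h ∷ A ++ x ∷ [] ↭ C
    R↭C = subst (zs ++ h ∷ A ++ x ∷ [] ↭_) (sym split) (++-comm zs (h ∷ A ++ x ∷ []))

    finish : ∀ q ys {u} → q ∷ ys ++ x ∷ [] ↭ C → Cyclic {R = Adjacent} (q ∷ ys ++ x ∷ []) →
             (∀ {y} → Adjacent q y → y ∈ C) → Adjacent x u → u ∉ C → ∃[ c ] Proper r {Fin 3} c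
    finish q ys R↭C cyc q-inside x~u u∉C =
      colour-cycle {ys = ys} (reach (∈-resp-↭ R↭C (∈-++⁺ʳ (q ∷ ys) (here refl))))
        (linked-++ˡ (q ∷ ys ++ x ∷ []) cyc) (unique-resp-↭ (↭-sym R↭C) unique)
        (Linked.head (linked-++ʳ (q ∷ ys) (subst (Linked Adjacent) (cong (q ∷_) (++-assoc ys (x ∷ []) (q ∷ []))) cyc)))
        (∈-resp-↭ (↭-sym R↭C) ∘ q-inside) x~u (u∉C ∘ ∈-resp-↭ R↭C)
      where
      along : ∀ {v} xs → Linked Adjacent (v ∷ xs) → ∀ {w} → w ∈ v ∷ xs → Walk v w
      along _        _       (here refl) = []
      along (_ ∷ xs) (a ∷ l) (there w∈)  = a ∷ along xs l w∈

      reach : ∀ {v} → v ∈ C → Walk r v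
      reach v∈C = reachable ++ʷ along (ys′ ++ t ∷ []) (linked-++ˡ C cyclic) v∈C
        where ys′ = EndCycle.ys E

    go : ∀ zs {u} → zs ++ h ∷ A ++ x ∷ [] ↭ C → Cyclic {R = Adjacent} (zs ++ h ∷ A ++ x ∷ []) →
         (∀ {z} → z ∈ zs → ¬ Outside C z) → Adjacent x u → u ∉ C → ∃[ c ] Proper r {Fin 3} c
    -- When `x` is the last vertex of the list, its successor on the cycle is `h`, all of whose
    -- neighbours lie in `C`.
    go []       perm cyc none = finish h A perm cyc inside
    go (z ∷ zs) perm cyc none = finish z (zs ++ h ∷ A)
      (subst (_↭ C) (sym assoc) perm) (subst Cyclic (sym assoc) cyc) (inside-if (none (here refl)))
      where
      assoc : z ∷ (zs ++ h ∷ A) ++ x ∷ [] ≡ z ∷ zs ++ h ∷ A ++ x ∷ []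
      assoc = cong (z ∷_) (++-assoc zs (h ∷ A) (x ∷ []))

  -- The chord joining v₀ and m is innermost: among the vertices of B only c
  -- is adjacent to d.
  record ChordedCycle (C : List Vertex) : Set where
    field
      {v₀ d m c p} : Vertex
      B D    : List Vertex
      perm   : v₀ ∷ B ++ d ∷ m ∷ D ↭ C
      linked : Linked Adjacent (v₀ ∷ B ++ d ∷ m ∷ D ++ v₀ ∷ [])
      v₀~m   : Adjacent v₀ m
      only-c : ∀ {y} → y ∈ B → Adjacent d y → y ≡ c
      d~p    : Adjacent d p
      p∈D    : p ∈ D

  -- The search moves on to the successor as long as that vertex has a neighbour further along.
  -- Where it stops, `m` still has one, while `d′` has none beyond `e`, the vertex right after it.
  innermost : ∀ x d zs → Any (Adjacent x) zs →
              ∃[ pre ] ∃[ m ] ∃[ d′ ] ∃[ e ] ∃[ zs′ ] x ∷ d ∷ zs ≡ pre ++ m ∷ d′ ∷ e ∷ zs′ ×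
              Any (Adjacent m) (e ∷ zs′) × ¬ Any (Adjacent d′) zs′
  innermost x d (e ∷ zs) some with Any.any? (adjacent? d) zs
  ... | no none = [] , x , d , e , zs , refl , some , none
  ... | yes later =
    let pre , m , d′ , e′ , zs′ , eq , rest = innermost d e zs later in
    x ∷ pre , m , d′ , e′ , zs′ , cong (x ∷_) eq , rest

  -- The closing edge of the cycle is the chord with which the search starts. The result is then
  -- read backwards from `v₀`, so that `d` comes just before `m`.
  chorded-cycle : ∀ {r} (E : EndCycle r) → let open EndCycle E in
                  (∀ {x u} → x ∈ C → Adjacent x u → u ∈ C) → ChordedCycle C
  chorded-cycle E closed = go ys refl
    where
    open EndCycle E
    go : ∀ zs → ys ≡ zs → ChordedCycle C
    -- A cycle on two vertices cannot hold the three neighbours of `h`.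
    go [] refl = ⊥-elim (absurd (inside adj₁))
      where
      open Neighbours (neighbours h~t)
      absurd : n₁ ∈ h ∷ t ∷ [] → ⊥
      absurd (here eq)         = Adjacent⇒≢ adj₁ (sym eq)
      absurd (there (here eq)) = n₁≢w eq
    go (z ∷ zs) refl with innermost h z (zs ++ t ∷ []) (lose (∈-++⁺ʳ zs (here refl)) h~t)
    ... | pre , m , d , e , zs′ , eq , chord , none with find chord
    ... | v₀ , v₀∈ , m~v₀ with ∈-∃++ v₀∈
    ... | B , A , eq′ = record
      { v₀ = v₀ ; d = d ; m = m ; c = e ; p = proj₁ p
      ; B = reverse B ; D = reverse (A ++ pre)
      ; perm   = perm
      ; linked = subst (λ l → Linked Adjacent (v₀ ∷ l)) (trans (cong (_++ v₀ ∷ []) reversed)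
          (++-assoc (reverse B) (d ∷ m ∷ reverse (A ++ pre)) (v₀ ∷ [])))
          (reverse-cycle Adjacent-sym v₀ _ rotated)
      ; v₀~m   = Adjacent-sym m~v₀
      ; only-c = λ y∈ d~y → only (∈-resp-↭ (↭-reverse B) y∈) d~y
      ; d~p    = proj₁ (proj₂ p)
      ; p∈D    = ∈-resp-↭ (↭-sym (↭-reverse (A ++ pre))) (∈-++⁺ʳ A (proj₂ (proj₂ p)))
      }
      where
      split : C ≡ (pre ++ m ∷ d ∷ B) ++ v₀ ∷ A
      split = trans eq (trans (cong (λ l → pre ++ m ∷ d ∷ l) eq′) (sym (++-assoc pre (m ∷ d ∷ B) (v₀ ∷ A))))

      rotated : Cyclic {R = Adjacent} (v₀ ∷ A ++ pre ++ m ∷ d ∷ B)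
      rotated = rotate (pre ++ m ∷ d ∷ B) (v₀ ∷ A) (subst Cyclic split cyclic)

      reversed : reverse (A ++ pre ++ m ∷ d ∷ B) ≡ reverse B ++ d ∷ m ∷ reverse (A ++ pre)
      reversed = begin
        reverse (A ++ pre ++ m ∷ d ∷ B)                 ≡⟨ cong reverse (++-assoc A pre _) ⟨
        reverse ((A ++ pre) ++ m ∷ d ∷ B)               ≡⟨ reverse-++ (A ++ pre) (m ∷ d ∷ B) ⟩
        reverse (m ∷ d ∷ B) ++ reverse (A ++ pre)       ≡⟨ cong (_++ reverse (A ++ pre)) (trans (unfold-reverse m (d ∷ B))
                                                              (cong (_++ m ∷ []) (unfold-reverse d B))) ⟩
        ((reverse B ++ d ∷ []) ++ m ∷ []) ++ reverse (A ++ pre) ≡⟨ ++-assoc (reverse B ++ d ∷ []) (m ∷ []) _ ⟩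
        (reverse B ++ d ∷ []) ++ m ∷ reverse (A ++ pre) ≡⟨ ++-assoc (reverse B) (d ∷ []) _ ⟩
        reverse B ++ d ∷ m ∷ reverse (A ++ pre)         ∎
        where open ≡-Reasoning

      perm : v₀ ∷ reverse B ++ d ∷ m ∷ reverse (A ++ pre) ↭ C
      perm = subst₂ _↭_ (cong (v₀ ∷_) reversed) (sym split)
        (↭-trans (↭-prep v₀ (↭-reverse (A ++ pre ++ m ∷ d ∷ B))) (++-comm (v₀ ∷ A) (pre ++ m ∷ d ∷ B)))

      only : ∀ {y} → y ∈ B → Adjacent d y → y ≡ e
      only y∈B d~y with subst (_ ∈_) (sym eq′) (∈-++⁺ˡ {ys = v₀ ∷ A} y∈B)
      ... | here y≡e    = y≡e
      ... | there y∈zs′ = contradiction (lose y∈zs′ d~y) none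

      d∈C : d ∈ C
      d∈C = subst (d ∈_) (sym eq) (∈-++⁺ʳ pre (there (here refl)))

      d~m : Adjacent d m
      d~m = Adjacent-sym (Linked.head (linked-++ʳ pre (subst (Linked Adjacent) eq (linked-++ˡ C cyclic))))

      locate : ∀ {p} → Adjacent d p → p ≢ m → p ≢ e → p ∈ pre
      locate {p} d~p p≢m p≢e with ∈-++⁻ pre (subst (p ∈_) eq (closed d∈C d~p))
      ... | inj₁ p∈                            = p∈
      ... | inj₂ (here p≡m)                    = contradiction p≡m p≢m
      ... | inj₂ (there (here p≡d))            = contradiction (sym p≡d) (Adjacent⇒≢ d~p)
      ... | inj₂ (there (there (here p≡e)))    = contradiction p≡e p≢e
      ... | inj₂ (there (there (there p∈zs′))) = contradiction (lose p∈zs′ d~p) none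

      -- Of the two neighbours of `d` other than `m`, one differs from `e` and can only come before
      -- `m`. Hence `pre` is not empty, and the chord found is not the closing edge.
      p : ∃[ p ] Adjacent d p × p ∈ pre
      p with Neighbours.n₁ (neighbours d~m) ≟ᵛ e
      ... | no n₁≢e  = _ , adj₁ , locate adj₁ n₁≢w n₁≢e
        where open Neighbours (neighbours d~m)
      ... | yes n₁≡e = _ , adj₂ , locate adj₂ n₂≢w (λ n₂≡e → n₁≢n₂ (trans n₁≡e (sym n₂≡e)))
        where open Neighbours (neighbours d~m)

  -- Hamiltonian components

  separated-weaken : ∀ {f} {P Q : Vertex → Set} → (∀ {x} → Q x → P x) → Separated f P → Separated f Q
  separated-weaken Q⊆P sep qu qv = sep (Q⊆P qu) (Q⊆P qv)

  -- The most that a run over the list can add to the total of the vertex after it: only the edge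
  -- from the last vertex of the list gets there, and an empty list has none.
  gap : List Vertex → ℕ
  gap []      = 0
  gap (_ ∷ _) = 2

  record Run (f : Weighting) (P : Vertex → Set) (ys : List Vertex) (ℓ : Vertex) : Set where
    field
      result    : Weighting
      separated : Separated result (λ x → P x ⊎ x ∈ ys)
      totals    : x ∉ ys ++ ℓ ∷ [] → total result x ≡ total f x
      weights   : Joins ε x y → x ∉ ys ++ ℓ ∷ [] → result ε ≡ f ε
      last      : total result ℓ ≤ total f ℓ + gap ys

  -- Each vertex of `ys` is settled by the edge to the next one, which is unsettled at that moment;
  -- `ℓ` itself stays unsettled.
  run : ∀ ys {ℓ f P} → Linked Adjacent (ys ++ ℓ ∷ []) → Unique (ys ++ ℓ ∷ []) →
        (∀ {y} → y ∈ ys ++ ℓ ∷ [] → ¬ P y) → Separated f P → Run f P ys ℓ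
  run [] {f = f} _ _ _ sep = record
    { result    = f
    ; separated = separated-weaken (λ { (inj₁ px) → px }) sep
    ; totals    = λ _ → refl
    ; weights   = λ _ _ → refl
    ; last      = ℕ.m≤m+n _ 0
    }
  run (y ∷ ys) {ℓ} {f} {P} l (y# ∷ uni) fresh sep = record
    { result    = R.result
    ; separated = separated-weaken
        (λ { (inj₁ px) → inj₁ (inj₁ px) ; (inj₂ (here x≡y)) → inj₁ (inj₂ x≡y) ; (inj₂ (there x∈)) → inj₂ x∈ }) R.separated
    ; totals    = λ x∉ → trans (R.totals (x∉ ∘ there))
        (total-other {ε₀} f a j (x∉ ∘ here) (λ { refl → x∉ (there n∈) }))
    ; weights   = λ {ε} k x∉ → trans (R.weights {ε} k (x∉ ∘ there))
        (update-≢ _≟ᵉ_ f ε₀ a λ { refl → Sum.[ x∉ ∘ here , (λ { refl → x∉ (there n∈) }) ]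
          (Incident⇒end {ε₀} j (Joins⇒Incident {ε} k)) })
    ; last      = bound ys refl
    }
    where
    successor : ∀ ys → Linked Adjacent (y ∷ ys ++ ℓ ∷ []) → ∃[ n ] Adjacent y n × n ∈ ys ++ ℓ ∷ [] × (ys ≡ [] ⊎ n ∈ ys)
    successor []      (a ∷ _) = _ , a , here refl , inj₁ refl
    successor (_ ∷ _) (a ∷ _) = _ , a , here refl , inj₂ (here refl)

    n  = proj₁ (successor ys l)
    ε₀ = proj₁ (proj₁ (proj₂ (successor ys l)))
    j  = proj₂ (proj₁ (proj₂ (successor ys l)))
    n∈ = proj₁ (proj₂ (proj₂ (successor ys l)))

    settled = settle {e = ε₀} {f = f} {P = P} sep j (fresh (here refl)) (fresh (there n∈))
    a  = proj₁ settled
    f₁ = f ⟦ ε₀ ≔ a ⟧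

    rest : Run f₁ (λ x → P x ⊎ x ≡ y) ys ℓ
    rest = run ys (Linked.tail l) uni
      (λ z∈ → λ { (inj₁ pz) → fresh (there z∈) pz ; (inj₂ refl) → All.lookup y# z∈ refl }) (proj₂ settled)

    module R = Run rest

    increase : ∀ {x} → total f₁ x + toℕ (f ε₀) ≡ total f x + toℕ a → total f₁ x ≤ total f x + 2
    increase {x} eq = ℕ.≤-trans (ℕ.m≤m+n _ (toℕ (f ε₀))) (ℕ.≤-trans (ℕ.≤-reflexive eq)
      (ℕ.+-monoʳ-≤ (total f x) (toℕ≤2 a)))
      where
      toℕ≤2 : ∀ (a : Fin 3) → toℕ a ≤ 2
      toℕ≤2 zero             = z≤n
      toℕ≤2 (suc zero)       = s≤s z≤n
      toℕ≤2 (suc (suc zero)) = s≤s (s≤s z≤n)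

    ℓ∈ : ℓ ∈ ys ++ ℓ ∷ []
    ℓ∈ = ∈-++⁺ʳ ys (here refl)

    bound : ∀ zs → ys ≡ zs → total R.result ℓ ≤ total f ℓ + 2
    bound [] refl = ℕ.≤-trans R.last (ℕ.≤-trans (ℕ.≤-reflexive (ℕ.+-identityʳ _))
      (increase {ℓ} (total-incident f ε₀ a (Joins⇒Incident {ε₀} (Joins-sym {ε₀} (subst (Joins ε₀ y) n≡ℓ j))))))
      where
      n≡ℓ : n ≡ ℓ
      n≡ℓ with n∈
      ... | here eq = eq
    bound (z ∷ zs) refl = ℕ.≤-trans R.last (ℕ.≤-reflexive (cong (_+ 2)
      (total-other {ε₀} f a j (All.lookup y# ℓ∈ ∘ sym) ℓ≢n)))
      where
      ℓ≢n : ℓ ≢ n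
      ℓ≢n ℓ≡n with proj₂ (proj₂ (proj₂ (successor ys l)))
      ... | inj₂ n∈ys = unique-disjoint (z ∷ zs) uni n∈ys (here (sym ℓ≡n))

  -- Giving the edges from v₀ to its successor and to m weight 2 makes the
  -- total of v₀ at least 4.  The other vertices are settled in cyclic order,
  -- each by the edge to its successor, while the totals of the three
  -- neighbours of v₀ are kept below that of v₀.
  module _ {v₀ d m e p ℓ : Vertex} {B D′ : List Vertex}
           (linked : Linked Adjacent (v₀ ∷ B ++ d ∷ m ∷ (D′ ++ ℓ ∷ []) ++ v₀ ∷ []))
           (unique : Unique (v₀ ∷ B ++ d ∷ m ∷ D′ ++ ℓ ∷ []))
           (v₀~m : Adjacent v₀ m)
           (only-e : ∀ {y} → y ∈ B → Adjacent d y → y ≡ e)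
           (d~p : Adjacent d p)
           (p∈D : p ∈ D′ ++ ℓ ∷ []) where

    private
      two : Fin 3
      two = suc (suc zero)

      D : List Vertex
      D = D′ ++ ℓ ∷ []

      unique-tail : Unique (B ++ d ∷ m ∷ D)
      unique-tail = unique-++ʳ (v₀ ∷ []) unique

      unique-dmD : Unique (d ∷ m ∷ D)
      unique-dmD = unique-++ʳ B unique-tail

      unique-D : Unique D
      unique-D = unique-++ʳ (d ∷ m ∷ []) unique-dmD

      v₀∉ : v₀ ∉ B ++ d ∷ m ∷ D
      v₀∉ = unique-disjoint (v₀ ∷ []) unique (here refl)

      v₀∉dmD : v₀ ∉ d ∷ m ∷ D
      v₀∉dmD = v₀∉ ∘ ∈-++⁺ʳ B

      B∉dmD : x ∈ B → x ∉ d ∷ m ∷ D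
      B∉dmD = unique-disjoint B unique-tail

      d∉mD : d ∉ m ∷ D
      d∉mD = unique-disjoint (d ∷ []) unique-dmD (here refl)

      m∉D : m ∉ D
      m∉D = unique-disjoint (d ∷ m ∷ []) unique-dmD (there (here refl))

      ℓ∈D : ℓ ∈ D
      ℓ∈D = ∈-++⁺ʳ D′ (here refl)

      linked-dmD : Linked Adjacent (d ∷ m ∷ D ++ v₀ ∷ [])
      linked-dmD = linked-++ʳ (v₀ ∷ B) linked

      d~m : Adjacent d m
      d~m = Linked.head linked-dmD

      linked-D : Linked Adjacent (D ++ v₀ ∷ [])
      linked-D = linked-++ʳ (d ∷ m ∷ []) linked-dmD

      ℓ~v₀ : Adjacent ℓ v₀
      ℓ~v₀ = Linked.head (linked-++ʳ D′ (subst (Linked Adjacent) (++-assoc D′ (ℓ ∷ []) (v₀ ∷ [])) linked-D))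

      -- The bound 1 on `D` leaves room for a later increase by 2 while staying below 4. `weight-D`
      -- ensures that the edges from `m` into `D` and from `ℓ` to `v₀` still weigh 0, so that giving
      -- them a weight raises totals by exactly that weight.
      record UpTo-d : Set where
        field
          f         : Weighting
          {v₁}      : Vertex
          v₀~v₁     : Adjacent v₀ v₁
          v₁∈       : v₁ ∈ B ⊎ v₁ ≡ d
          separated : Separated f (λ x → x ∈ B ⊎ x ≡ d)
          total-v₀  : total f v₀ ≡ 4
          total-v₁  : total f v₁ ≡ 2
          total-m   : total f m ≡ 2
          total-D   : x ∈ D → total f x ≤ 1
          weight-D  : Joins ε x y → x ∈ D → y ≡ m ⊎ y ≡ v₀ → f ε ≡ zero

      module Start {v₁} (v₀~v₁ : Adjacent v₀ v₁) (v₁∉mD : v₁ ∉ m ∷ D) where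

        ε₀ = proj₁ v₀~v₁
        ζ  = proj₁ v₀~m

        ζ≢ε₀ : ζ ≢ ε₀
        ζ≢ε₀ eq = v₁∉mD (here (Joins-injective {ζ} (subst (λ ε → Joins ε v₀ v₁) (sym eq) (proj₂ v₀~v₁)) (proj₂ v₀~m)))

        g f : Weighting
        g = (λ _ → zero) ⟦ ε₀ ≔ two ⟧
        f = g ⟦ ζ ≔ two ⟧

        gζ : g ζ ≡ zero
        gζ = update-≢ _≟ᵉ_ (λ _ → zero) ε₀ two ζ≢ε₀

        total-v₀ : total f v₀ ≡ 4
        total-v₀ = trans (raise-left {ζ} {f = g} two (proj₂ v₀~m) gζ)
          (cong (_+ 2) (trans (raise-left {ε₀} {f = λ _ → zero} two (proj₂ v₀~v₁) refl) (cong (_+ 2) (total-zero v₀))))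

        total-v₁ : total f v₁ ≡ 2
        total-v₁ = trans (total-other {ζ} g two (proj₂ v₀~m) (Adjacent⇒≢ v₀~v₁ ∘ sym) (v₁∉mD ∘ here))
          (trans (raise-right {ε₀} {f = λ _ → zero} two (proj₂ v₀~v₁) refl) (cong (_+ 2) (total-zero v₁)))

        total-m : total f m ≡ 2
        total-m = trans (raise-right {ζ} {f = g} two (proj₂ v₀~m) gζ)
          (cong (_+ 2) (trans
            (total-other {ε₀} (λ _ → zero) two (proj₂ v₀~v₁) (Adjacent⇒≢ v₀~m ∘ sym) (v₁∉mD ∘ here ∘ sym))
            (total-zero m)))

        total-D : x ∈ D → total f x ≡ 0
        total-D {x} x∈D = trans (total-other {ζ} g two (proj₂ v₀~m) x≢v₀ (λ { refl → m∉D x∈D }))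
          (trans (total-other {ε₀} (λ _ → zero) two (proj₂ v₀~v₁) x≢v₀ (λ { refl → v₁∉mD (there x∈D) })) (total-zero x))
          where
          x≢v₀ : x ≢ v₀
          x≢v₀ refl = v₀∉dmD (there (there x∈D))

        weight-D : Joins ε x y → x ∈ D → f ε ≡ zero
        weight-D {ε} {x} j x∈D = trans
          (update-≢ _≟ᵉ_ g ζ two
            (λ { refl → Sum.[ x≢v₀ , (λ { refl → m∉D x∈D }) ]
              (Incident⇒end {ζ} (proj₂ v₀~m) (Joins⇒Incident {ζ} j)) }))
          (update-≢ _≟ᵉ_ (λ _ → zero) ε₀ two
            (λ { refl → Sum.[ x≢v₀ , (λ { refl → v₁∉mD (there x∈D) }) ]
              (Incident⇒end {ε₀} (proj₂ v₀~v₁) (Joins⇒Incident {ε₀} j)) }))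
          where
          x≢v₀ : x ≢ v₀
          x≢v₀ refl = v₀∉dmD (there (there x∈D))

      up-to-d : UpTo-d
      up-to-d = go B refl
        where
        go : ∀ zs → B ≡ zs → UpTo-d
        -- With `B` empty, `d` is itself the successor of `v₀` and keeps its total 2.
        go [] refl = record
          { f = S.f ; v₀~v₁ = v₀~d ; v₁∈ = inj₂ refl
          ; separated = λ { (inj₂ refl) (inj₂ refl) a → contradiction refl (Adjacent⇒≢ a) }
          ; total-v₀ = S.total-v₀ ; total-v₁ = S.total-v₁ ; total-m = S.total-m
          ; total-D  = λ x∈D → ℕ.≤-trans (ℕ.≤-reflexive (S.total-D x∈D)) z≤n
          ; weight-D = λ {ε} j x∈D _ → S.weight-D {ε} j x∈D
          }
          where
          v₀~d : Adjacent v₀ d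
          v₀~d = Linked.head linked
          module S = Start v₀~d d∉mD
        go (v₁ ∷ B′) refl = record
          { f = f ; v₀~v₁ = v₀~v₁ ; v₁∈ = inj₁ (here refl)
          ; separated = separated
          ; total-v₀ = trans (other (λ { refl → v₀∉dmD (here refl) }) (λ { refl → v₀∉dmD (there (there p∈D)) }))
              (trans (R.totals (λ v₀∈ → v₀∉ (there (∈-B′d v₀∈)))) S.total-v₀)
          ; total-v₁ = trans (other (λ { refl → B∉dmD (here refl) (here refl) }) (λ { refl → v₁∉mD (there p∈D) }))
              (trans (R.totals v₁∉B′d) S.total-v₁)
          ; total-m  = trans (other (λ { refl → d∉mD (here refl) }) (λ { refl → m∉D p∈D }))
              (trans (R.totals (outside (there (here refl)) (λ { refl → d∉mD (here refl) }))) S.total-m)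
          ; total-D  = total-D
          ; weight-D = λ {ε} {x} {y} j x∈D y∈ → trans
              (update-≢ _≟ᵉ_ R.result γ a (λ { refl → γ-apart x∈D y∈ j }))
              (trans (R.weights {ε} j (D-outside x∈D)) (S.weight-D {ε} j x∈D))
          }
          where
          v₀~v₁ : Adjacent v₀ v₁
          v₀~v₁ = Linked.head linked

          v₁∉mD : v₁ ∉ m ∷ D
          v₁∉mD = B∉dmD (here refl) ∘ there

          module S = Start v₀~v₁ v₁∉mD

          unique-B′d : Unique (B′ ++ d ∷ [])
          unique-B′d = unique-++ˡ (B′ ++ d ∷ []) (subst Unique (sym (++-assoc B′ (d ∷ []) (m ∷ D)))
            (unique-++ʳ (v₁ ∷ []) unique-tail))

          linked-B′d : Linked Adjacent (B′ ++ d ∷ [])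
          linked-B′d = linked-++ˡ (B′ ++ d ∷ []) (subst (Linked Adjacent) (sym (++-assoc B′ (d ∷ []) _))
            (linked-++ʳ (v₀ ∷ v₁ ∷ []) linked))

          ∈-B′d : x ∈ B′ ++ d ∷ [] → x ∈ B′ ++ d ∷ m ∷ D
          ∈-B′d x∈ with ∈-++⁻ B′ x∈
          ... | inj₁ x∈B′        = ∈-++⁺ˡ x∈B′
          ... | inj₂ (here refl) = ∈-++⁺ʳ B′ (here refl)

          v₁∉B′d : v₁ ∉ B′ ++ d ∷ []
          v₁∉B′d = unique-disjoint (v₁ ∷ []) unique-tail (here refl) ∘ ∈-B′d

          outside : x ∈ d ∷ m ∷ D → x ≢ d → x ∉ B′ ++ d ∷ []
          outside x∈ x≢d x∈B′d with ∈-++⁻ B′ x∈B′d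
          ... | inj₁ x∈B′       = B∉dmD (there x∈B′) x∈
          ... | inj₂ (here x≡d) = x≢d x≡d

          D-outside : x ∈ D → x ∉ B′ ++ d ∷ []
          D-outside x∈D = outside (there (there x∈D)) (λ { refl → d∉mD (there x∈D) })

          -- The vertex `v₁` counts as settled with total 2, and the vertices after it adapt to it.
          run-B′ : Run S.f (_≡ v₁) B′ d
          run-B′ = run B′ linked-B′d unique-B′d (λ { y∈ refl → v₁∉B′d y∈ })
            (λ { refl refl a → contradiction refl (Adjacent⇒≢ a) })

          module R = Run run-B′

          γ = proj₁ d~p
          Rγ : R.result γ ≡ zero
          Rγ = trans (R.weights {γ} (Joins-sym {γ} (proj₂ d~p)) (D-outside p∈D)) (S.weight-D {γ} (Joins-sym {γ} (proj₂ d~p)) p∈D)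

          -- Settling `d` by its edge to `m` could make `m` too large. The edge to `p` is used
          -- instead, and as `e` is the only possible neighbour of `d` in `B`, weight 0 or 1 is
          -- enough.
          chosen = avoid-total (total R.result d) (total R.result e)
          a = proj₁ chosen
          f = R.result ⟦ γ ≔ a ⟧

          other : x ≢ d → x ≢ p → total f x ≡ total R.result x
          other = total-other {γ} R.result a (proj₂ d~p)

          B-other : x ∈ v₁ ∷ B′ → total f x ≡ total R.result x
          B-other x∈B = other (λ { refl → B∉dmD x∈B (here refl) }) (λ { refl → B∉dmD x∈B (there (there p∈D)) })

          separated : Separated f (λ x → x ∈ v₁ ∷ B′ ⊎ x ≡ d)
          separated = separated-insert {f′ = f}
            (separated-weaken {Q = _∈ v₁ ∷ B′} (λ { (here refl) → inj₁ refl ; (there x∈) → inj₂ x∈ }) R.separated)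
            B-other
            λ {x} x∈B d~x eq → proj₂ (proj₂ chosen)
              (trans (sym (raise-left {γ} {f = R.result} a (proj₂ d~p) Rγ))
                (trans eq (cong (total R.result) (only-e x∈B d~x))))

          total-D : x ∈ D → total f x ≤ 1
          total-D {x} x∈D with x ≟ᵛ p
          ... | yes refl = ℕ.≤-trans (ℕ.≤-reflexive (trans (raise-right {γ} {f = R.result} a (proj₂ d~p) Rγ)
            (cong (_+ toℕ a) (trans (R.totals (D-outside x∈D)) (S.total-D x∈D))))) (proj₁ (proj₂ chosen))
          ... | no x≢p = ℕ.≤-trans (ℕ.≤-reflexive (trans (other (λ { refl → d∉mD (there x∈D) }) x≢p)
            (trans (R.totals (D-outside x∈D)) (S.total-D x∈D)))) z≤n

          γ-apart : x ∈ D → y ≡ m ⊎ y ≡ v₀ → ¬ Joins γ x y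
          γ-apart x∈D y∈ j with Incident⇒end {γ} j (Joins⇒Incident {γ} (proj₂ d~p))
          γ-apart x∈D y∈          j | inj₁ refl = d∉mD (there x∈D)
          γ-apart x∈D (inj₁ refl) j | inj₂ refl = d∉mD (here refl)
          γ-apart x∈D (inj₂ refl) j | inj₂ refl = v₀∉dmD (here refl)

      module U = UpTo-d up-to-d

      next-of-m : ∃[ n ] Adjacent m n × (∃[ zs ] D ≡ n ∷ zs) × (D′ ≡ [] ⊎ n ∈ D′)
      next-of-m = go D′ refl
        where
        go : ∀ zs → D′ ≡ zs → ∃[ n ] Adjacent m n × (∃[ zs′ ] D ≡ n ∷ zs′) × (D′ ≡ [] ⊎ n ∈ D′)
        go []       refl = ℓ , Linked.head (linked-++ʳ (d ∷ []) linked-dmD) , (_ , refl) , inj₁ refl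
        go (n ∷ zs) refl = n , Linked.head (linked-++ʳ (d ∷ []) linked-dmD) , (_ , refl) , inj₂ (here refl)

      n   = proj₁ next-of-m
      ε₃  = proj₁ (proj₁ (proj₂ next-of-m))
      m~n = proj₂ (proj₁ (proj₂ next-of-m))

      n∈D : n ∈ D
      n∈D = subst (n ∈_) (sym (proj₂ (proj₁ (proj₂ (proj₂ next-of-m))))) (here refl)

      ≢n : x ∉ D → x ≢ n
      ≢n x∉D x≡n = x∉D (subst (_∈ D) (sym x≡n) n∈D)

      -- Among the neighbours of `m` only `d` is settled, since `v₀` comes last and `n` lies in `D`.
      -- So a weight of at most 1 will do, and `m` ends with at most 3.
      chosen₃ = avoid-total (total U.f m) (total U.f d)
      a₃ = proj₁ chosen₃
      f₃ = U.f ⟦ ε₃ ≔ a₃ ⟧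

      Uε₃ : U.f ε₃ ≡ zero
      Uε₃ = U.weight-D {ε₃} (Joins-sym {ε₃} m~n) n∈D (inj₁ refl)

      P₂ P₃ : Vertex → Set
      P₂ x = x ∈ B ⊎ x ≡ d
      P₃ x = P₂ x ⊎ x ≡ m

      P₂⇒∉ : P₂ x → x ∉ m ∷ D
      P₂⇒∉ (inj₁ x∈B)  = B∉dmD x∈B ∘ there
      P₂⇒∉ (inj₂ refl) = d∉mD

      other₃ : x ≢ m → x ≢ n → total f₃ x ≡ total U.f x
      other₃ = total-other {ε₃} U.f a₃ m~n

      P₂-other₃ : P₂ x → total f₃ x ≡ total U.f x
      P₂-other₃ px = other₃ (λ { refl → P₂⇒∉ px (here refl) }) (≢n (P₂⇒∉ px ∘ there))

      v₀-other₃ : total f₃ v₀ ≡ total U.f v₀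
      v₀-other₃ = other₃ (λ { refl → v₀∉dmD (there (here refl)) }) (≢n (v₀∉dmD ∘ there ∘ there))

      neighbours-of-m : Adjacent m x → x ≡ v₀ ⊎ x ≡ d ⊎ x ≡ n
      neighbours-of-m = only-three (Adjacent-sym v₀~m) (Adjacent-sym d~m) (ε₃ , m~n)
        (λ { refl → v₀∉dmD (here refl) }) (≢n (v₀∉dmD ∘ there ∘ there)) (≢n (d∉mD ∘ there))

      separated₃ : Separated f₃ P₃
      separated₃ = separated-insert {f′ = f₃} U.separated P₂-other₃ λ px m~x eq → case neighbours-of-m m~x of λ
        { (inj₁ refl)        → Sum.[ (λ v₀∈B → v₀∉ (∈-++⁺ˡ v₀∈B)) , (λ v₀≡d → v₀∉dmD (here v₀≡d)) ] px
        ; (inj₂ (inj₁ refl)) → proj₂ (proj₂ chosen₃) (trans (sym (raise-left {ε₃} {f = U.f} a₃ m~n Uε₃)) eq)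
        ; (inj₂ (inj₂ refl)) → P₂⇒∉ px (there n∈D) }

      run-D′ : Run f₃ P₃ D′ ℓ
      run-D′ = run D′ (linked-++ˡ D linked-D) unique-D
        (λ { y∈D (inj₁ px) → P₂⇒∉ px (there y∈D) ; y∈D (inj₂ refl) → m∉D y∈D }) separated₃

      module R₄ = Run run-D′

      -- If `D′` is empty, `ℓ` is `n`, with at most 1 from before and at most 1 from the edge to
      -- `m`. Otherwise it has at most 1, and the run adds at most 2.
      total₃-ℓ : total f₃ ℓ + gap D′ ≤ 3
      total₃-ℓ = go D′ refl (proj₂ (proj₂ (proj₂ next-of-m)))
        where
        raise : total f₃ n ≤ 2
        raise = ℕ.≤-trans (ℕ.≤-reflexive (raise-right {ε₃} {f = U.f} a₃ m~n Uε₃))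
          (ℕ.+-mono-≤ (U.total-D n∈D) (proj₁ (proj₂ chosen₃)))

        go : ∀ zs → D′ ≡ zs → D′ ≡ [] ⊎ n ∈ D′ → total f₃ ℓ + gap zs ≤ 3
        go [] refl _ = ℕ.≤-trans (ℕ.≤-reflexive (ℕ.+-identityʳ _))
          (ℕ.≤-trans (subst (λ x → total f₃ x ≤ 2) n≡ℓ raise) (ℕ.n≤1+n 2))
          where
          n≡ℓ : n ≡ ℓ
          n≡ℓ with n∈D
          ... | here eq = eq
        go (z ∷ zs) refl (inj₂ n∈D′) = ℕ.+-monoˡ-≤ 2 (ℕ.≤-trans
          (ℕ.≤-reflexive (other₃ (λ { refl → m∉D ℓ∈D }) (λ { ℓ≡n → unique-disjoint (z ∷ zs) unique-D n∈D′ (here (sym ℓ≡n)) })))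
          (U.total-D ℓ∈D))

      P₄ : Vertex → Set
      P₄ x = P₃ x ⊎ x ∈ D′

      ε₅ = proj₁ ℓ~v₀
      j₅ = proj₂ ℓ~v₀

      v₀∉P₄ : ¬ P₄ v₀
      v₀∉P₄ (inj₁ (inj₁ (inj₁ v₀∈B))) = v₀∉ (∈-++⁺ˡ v₀∈B)
      v₀∉P₄ (inj₁ (inj₁ (inj₂ v₀≡d))) = v₀∉dmD (here v₀≡d)
      v₀∉P₄ (inj₁ (inj₂ v₀≡m))        = v₀∉dmD (there (here v₀≡m))
      v₀∉P₄ (inj₂ v₀∈D′)              = v₀∉dmD (there (there (∈-++⁺ˡ v₀∈D′)))

      ℓ∉P₃ : ¬ P₃ ℓ
      ℓ∉P₃ (inj₁ pℓ)   = P₂⇒∉ pℓ (there ℓ∈D)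
      ℓ∉P₃ (inj₂ refl) = m∉D ℓ∈D

      ℓ∉P₄ : ¬ P₄ ℓ
      ℓ∉P₄ (inj₁ pℓ)   = ℓ∉P₃ pℓ
      ℓ∉P₄ (inj₂ ℓ∈D′) = unique-disjoint D′ unique-D ℓ∈D′ (here refl)

      settled = settle {e = ε₅} {f = R₄.result} {P = P₄} R₄.separated j₅ ℓ∉P₄ v₀∉P₄
      a₅ = proj₁ settled

    chorded-weighting : Weighting
    chorded-weighting = R₄.result ⟦ ε₅ ≔ a₅ ⟧

    private
      f₅ = chorded-weighting

      weight-ε₅ : R₄.result ε₅ ≡ zero
      weight-ε₅ = trans (R₄.weights {ε₅} (Joins-sym {ε₅} j₅) (v₀∉dmD ∘ there ∘ there))
        (trans (update-≢ _≟ᵉ_ U.f ε₃ a₃ ε₅≢ε₃) (U.weight-D {ε₅} j₅ ℓ∈D (inj₂ refl)))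
        where
        ε₅≢ε₃ : ε₅ ≢ ε₃
        ε₅≢ε₃ eq with Incident⇒end {ε₃} m~n (subst (Incident v₀) eq (Joins⇒Incident {ε₅} (Joins-sym {ε₅} j₅)))
        ... | inj₁ v₀≡m = v₀∉dmD (there (here v₀≡m))
        ... | inj₂ v₀≡n = ≢n (v₀∉dmD ∘ there ∘ there) v₀≡n

      total-v₀ : total f₅ v₀ ≡ 4 + toℕ a₅
      total-v₀ = trans (raise-right {ε₅} {f = R₄.result} a₅ j₅ weight-ε₅)
        (cong (_+ toℕ a₅) (trans (R₄.totals (v₀∉dmD ∘ there ∘ there)) (trans v₀-other₃ U.total-v₀)))

      -- The last edge raises `ℓ` and `v₀` by the same amount, so the comparison of at most 3 with 4
      -- persists whatever its weight.
      total-ℓ : total f₅ ℓ < total f₅ v₀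
      total-ℓ = ℕ.≤-trans (s≤s (ℕ.≤-trans (ℕ.≤-reflexive (raise-left {ε₅} {f = R₄.result} a₅ j₅ weight-ε₅))
        (ℕ.+-monoˡ-≤ (toℕ a₅) (ℕ.≤-trans R₄.last total₃-ℓ)))) (ℕ.≤-reflexive (sym total-v₀))

      unchanged : P₃ x → x ≢ v₀ → total f₅ x ≡ total f₃ x
      unchanged px x≢v₀ = trans (total-other {ε₅} R₄.result a₅ j₅ (λ { refl → ℓ∉P₃ px }) x≢v₀)
        (R₄.totals (λ x∈D → case px of λ { (inj₁ qx) → P₂⇒∉ qx (there x∈D) ; (inj₂ refl) → m∉D x∈D }))

      small : total f₅ x ≤ 3 → total f₅ x < total f₅ v₀
      small le = ℕ.≤-trans (s≤s le) (ℕ.≤-trans (ℕ.m≤m+n 4 (toℕ a₅)) (ℕ.≤-reflexive (sym total-v₀)))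

      total-v₁ : total f₅ U.v₁ < total f₅ v₀
      total-v₁ = small (ℕ.≤-trans (ℕ.≤-reflexive (trans (unchanged (inj₁ U.v₁∈) (Adjacent⇒≢ U.v₀~v₁ ∘ sym))
        (trans (P₂-other₃ U.v₁∈) U.total-v₁))) (ℕ.n≤1+n 2))

      total-m : total f₅ m < total f₅ v₀
      total-m = small (ℕ.≤-trans (ℕ.≤-reflexive (trans (unchanged (inj₂ refl) (Adjacent⇒≢ v₀~m ∘ sym))
        (trans (raise-left {ε₃} {f = U.f} a₃ m~n Uε₃) (cong (_+ toℕ a₃) U.total-m))))
        (ℕ.+-monoʳ-≤ 2 (proj₁ (proj₂ chosen₃))))

      v₀-largest : Adjacent v₀ x → total f₅ x < total f₅ v₀
      v₀-largest v₀~x = cases (only-three U.v₀~v₁ v₀~m (Adjacent-sym ℓ~v₀)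
        (λ v₁≡m → P₂⇒∉ U.v₁∈ (here v₁≡m))
        (λ v₁≡ℓ → P₂⇒∉ U.v₁∈ (there (subst (_∈ D) (sym v₁≡ℓ) ℓ∈D)))
        (λ { refl → m∉D ℓ∈D }) v₀~x)
        where
        cases : x ≡ U.v₁ ⊎ x ≡ m ⊎ x ≡ ℓ → total f₅ x < total f₅ v₀
        cases (inj₁ refl)        = total-v₁
        cases (inj₂ (inj₁ refl)) = total-m
        cases (inj₂ (inj₂ refl)) = total-ℓ

      classify : x ∈ v₀ ∷ B ++ d ∷ m ∷ D → x ≡ v₀ ⊎ (P₄ x ⊎ x ≡ ℓ)
      classify (here eq) = inj₁ eq
      classify (there x∈) with ∈-++⁻ B x∈
      ... | inj₁ x∈B                = inj₂ (inj₁ (inj₁ (inj₁ (inj₁ x∈B))))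
      ... | inj₂ (here eq)          = inj₂ (inj₁ (inj₁ (inj₁ (inj₂ eq))))
      ... | inj₂ (there (here eq))  = inj₂ (inj₁ (inj₁ (inj₂ eq)))
      ... | inj₂ (there (there x∈D)) with ∈-++⁻ D′ x∈D
      ... | inj₁ x∈D′      = inj₂ (inj₁ (inj₂ x∈D′))
      ... | inj₂ (here eq) = inj₂ (inj₂ eq)

    chorded-separated : Separated chorded-weighting (_∈ v₀ ∷ B ++ d ∷ m ∷ D)
    chorded-separated u∈ v∈ = cases (classify u∈) (classify v∈)
      where
      cases : x ≡ v₀ ⊎ (P₄ x ⊎ x ≡ ℓ) → y ≡ v₀ ⊎ (P₄ y ⊎ y ≡ ℓ) → Adjacent x y → total f₅ x ≢ total f₅ y
      cases (inj₁ refl) _           a eq = ℕ.<⇒≢ (v₀-largest a) (sym eq)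
      cases (inj₂ _)    (inj₁ refl) a eq = ℕ.<⇒≢ (v₀-largest (Adjacent-sym a)) eq
      cases (inj₂ px)   (inj₂ py)   a eq = proj₂ settled px py a eq

  -- Combining components

  abstract
    component-weighting : ∀ r → ∃[ f ] Proper r (total f)
    component-weighting r = decide (Any.any? (outside? C) C)
      where
      E : EndCycle r
      E = end-cycle r
      open EndCycle E

      decide : Dec (Any (Outside C) C) → ∃[ f ] Proper r (total f)
      decide (yes out) = from-colouring (proj₂ (colour-open-cycle E out))
      decide (no none) = weigh (chorded-cycle E closed)
        where
        closed : ∀ {x u} → x ∈ C → Adjacent x u → u ∈ C
        closed x∈C = inside-if (λ out → none (lose x∈C out))

        r∈C : r ∈ C
        r∈C = walk-closed {P = _∈ C} closed (reverseʷ reachable) (here refl)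

        weigh : ChordedCycle C → ∃[ f ] Proper r (total f)
        weigh K with ChordedCycle.D K | ChordedCycle.perm K | ChordedCycle.linked K | ChordedCycle.p∈D K
        ... | D | perm | linked | p∈D with initLast D
        -- The membership `p∈D` excludes an empty `D`, so there is a last vertex `ℓ` before the
        -- return to `v₀`.
        ... | D′ ∷ʳ′ ℓ = _ , λ p a →
          let u∈C = walk-closed {P = _∈ C} closed p r∈C in
          chorded-separated {B = B} {D′} linked (unique-resp-↭ (↭-sym perm) unique) v₀~m only-c d~p p∈D
            (∈-resp-↭ (↭-sym perm) u∈C) (∈-resp-↭ (↭-sym perm) (closed u∈C a)) a
          where open ChordedCycle K using (B; v₀~m; only-c; d~p)

  -- Weightings obtained from different vertices of one component need not agree. The first
  -- reachable vertex of a fixed list depends only on the component and makes the choice canonical.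
  representative : List Vertex → Vertex → Vertex
  representative []       v = v
  representative (x ∷ xs) v with walk? v x
  ... | yes _ = x
  ... | no  _ = representative xs v

  representative-reachable : ∀ xs v → Walk v (representative xs v)
  representative-reachable []       v = []
  representative-reachable (x ∷ xs) v with walk? v x
  ... | yes p = p
  ... | no  _ = representative-reachable xs v

  -- Both searches make the same decisions along the list. Since `u` occurs in it, they succeed
  -- before reaching the default, where they could differ.
  representative-cong : ∀ xs {u v} → Walk u v → u ∈ xs → representative xs u ≡ representative xs v
  representative-cong (x ∷ xs) {u} {v} p u∈ with walk? u x | walk? v x
  ... | yes _ | yes _ = refl
  ... | yes q | no ¬q = contradiction (reverseʷ p ++ʷ q) ¬q
  ... | no ¬q | yes q = contradiction (p ++ʷ q) ¬q
  representative-cong (x ∷ xs) p (here refl) | no ¬q | no _ = contradiction [] ¬q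
  representative-cong (x ∷ xs) p (there u∈)  | no _  | no _ = representative-cong xs p u∈

  root : Vertex → Vertex
  root = representative vertices

  root-cong : ∀ {u v} → Walk u v → root u ≡ root v
  root-cong p = representative-cong vertices p (Finite.complete vertex-finite _)

  weighting : Weighting
  weighting e = proj₁ (component-weighting (root (proj₁ (ends e)))) e

  total-weighting : ∀ v → total weighting v ≡ total (proj₁ (component-weighting (root v))) v
  total-weighting v = cong sum (map-cong-local (All.tabulate λ {e} e∈ → cong toℕ
    (cong (λ r → proj₁ (component-weighting r) e) (sym (root-cong (to-end {e} (incidences-∈ e∈)))))))
    where
    to-end : ∀ {e} → Incident v e → Walk v (proj₁ (ends e))
    to-end (inj₁ refl) = []
    to-end {e} (inj₂ refl) = (e , inj₂ refl) ∷ []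

  weighting-proper : ∀ {u v} → Adjacent u v → total weighting u ≢ total weighting v
  weighting-proper {u} {v} a eq =
    proj₂ (component-weighting (root u)) (reverseʷ (representative-reachable vertices u)) a
      (trans (sym (total-weighting u)) (trans eq (trans (total-weighting v)
        (cong (λ r → total (proj₁ (component-weighting r)) v) (sym (root-cong (a ∷ [])))))))

-- Paths and shadings

-- An edge of weight a becomes a parallel edges of colour 0 and 2 − a of
-- colour 1.
shade : Fin 3 → Fin 2 → Fin 2
shade zero             _ = suc zero
shade (suc zero)       b = b
shade (suc (suc zero)) _ = zero

multiplicity : Fin 2 → Fin 3 → ℕ
multiplicity zero       a = toℕ a
multiplicity (suc zero) a = 2 ∸ toℕ a

multiplicity-sum : ∀ a → multiplicity (suc zero) a + multiplicity zero a ≡ 2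
multiplicity-sum = from-yes (all? λ a → multiplicity (suc zero) a + multiplicity zero a ℕ.≟ 2)

multiplicity-injective : ∀ c a b → multiplicity c a ≡ multiplicity c b → a ≡ b
multiplicity-injective = from-yes (all? λ c → all? λ a → all? λ b →
  (multiplicity c a ℕ.≟ multiplicity c b) →-dec (a ≟³ b))

-- Whether a vertex of degree 3 and total s may be joined, by an edge of
-- weight a, to a vertex of degree 2 whose other edge has weight b.  For
-- colour 1 this compares 6 − s with 4 − (a + b).
Compatible : ℕ → Fin 3 → Fin 3 → Set
Compatible s a b = (1 ≤ toℕ a → s ≢ toℕ a + toℕ b) × (toℕ a ≤ 1 → s ≢ 2 + (toℕ a + toℕ b))

compatible? : ∀ s a b → Dec (Compatible s a b)
compatible? s a b = (1 ℕ.≤? toℕ a →-dec ¬? (s ℕ.≟ toℕ a + toℕ b)) ×-dec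
                    (toℕ a ℕ.≤? 1 →-dec ¬? (s ℕ.≟ 2 + (toℕ a + toℕ b)))

-- For `a` equal to 0 or 2 only one of the two conditions applies and excludes at most one `b`. For
-- `a = 1` the excluded values are `s - 1` and `s - 3`, which both lie in range only when `s = 3`;
-- then 1 remains. Beyond 6 nothing is excluded.
compatible-options : ∀ s a → (∃[ x ] (∀ b → b ≢ x → Compatible s a b)) ⊎ (s ≡ 3 × Compatible s a (suc zero))
compatible-options s a with s ℕ.<? 7
... | no s≮7 = inj₁ (zero , λ b _ →
  (λ _ eq → s≮7 (subst (_< 7) (sym eq) (large₁ a b))) ,
  (λ _ eq → s≮7 (subst (_< 7) (sym eq) (large₂ a b))))
  where
  large₁ : ∀ (a b : Fin 3) → toℕ a + toℕ b < 7
  large₁ = from-yes (all? λ (a : Fin 3) → all? λ (b : Fin 3) → toℕ a + toℕ b ℕ.<? 7)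
  large₂ : ∀ (a b : Fin 3) → 2 + (toℕ a + toℕ b) < 7
  large₂ = from-yes (all? λ (a : Fin 3) → all? λ (b : Fin 3) → 2 + (toℕ a + toℕ b) ℕ.<? 7)
... | yes s<7 = subst (λ s → (∃[ x ] (∀ b → b ≢ x → Compatible s a b)) ⊎ (s ≡ 3 × Compatible s a (suc zero)))
  (Fin.toℕ-fromℕ< s<7) (small (fromℕ< s<7) a)
  where
  small : ∀ (s : Fin 7) a → (∃[ x ] (∀ b → b ≢ x → Compatible (toℕ s) a b)) ⊎ (toℕ s ≡ 3 × Compatible (toℕ s) a (suc zero))
  small = from-yes (all? λ (s : Fin 7) → all? λ a →
    any? (λ x → all? λ b → ¬? (b ≟³ x) →-dec compatible? (toℕ s) a b) ⊎-dec
    ((toℕ s ℕ.≟ 3) ×-dec compatible? (toℕ s) a (suc zero)))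

-- At most one end can be exceptional, since both would have total 3. The other end misses at most
-- one value and can avoid the value forced at the exceptional one.
compatible-pair : ∀ {s t} a → s ≢ t → ∃[ b ] ∃[ c ] Compatible s a b × Compatible t a c × b ≢ c
compatible-pair {s} {t} a s≢t with compatible-options s a | compatible-options t a
... | inj₁ (x , okˢ) | inj₁ (y , okᵗ) =
  let b , b≢x , _ = avoid₂ x x ; c , c≢y , c≢b = avoid₂ y b in b , c , okˢ b b≢x , okᵗ c c≢y , c≢b ∘ sym
... | inj₁ (x , okˢ) | inj₂ (_ , okᵗ) =
  let b , b≢x , b≢1 = avoid₂ x (suc zero) in b , suc zero , okˢ b b≢x , okᵗ , b≢1
... | inj₂ (_ , okˢ) | inj₁ (y , okᵗ) =
  let c , c≢y , c≢1 = avoid₂ y (suc zero) in suc zero , c , okˢ , okᵗ c c≢y , c≢1 ∘ sym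
... | inj₂ (s≡3 , _) | inj₂ (t≡3 , _) = contradiction (trans s≡3 (sym t≡3)) s≢t

-- The weights of a path with `5 + n` edges, indexed from 0; values of `at` beyond `4 + n` have no
-- meaning.
record Filling (n : ℕ) (p q b w : Fin 3) : Set where
  field
    at    : ℕ → Fin 3
    at-0  : at 0 ≡ p
    at-1  : at 1 ≡ q
    at-b  : at (3 + n) ≡ b
    at-w  : at (4 + n) ≡ w
    apart : ∀ i → i ≤ 2 + n → at i ≢ at (2 + i)

-- With five edges, `q` and `b` are two places apart and the middle weight has just two conditions.
-- On a longer path the weight `m` after `q` must differ from `p`, and keeping it different from `b`
-- restores the hypothesis for the shorter path starting at `q`.
fill : ∀ n p q b w → q ≢ b → Filling n p q b w
fill zero p q b w q≢b with avoid₂ p w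
... | m , m≢p , m≢w = record
  { at = λ { 0 → p ; 1 → q ; 2 → m ; 3 → b ; _ → w }
  ; at-0 = refl ; at-1 = refl ; at-b = refl ; at-w = refl
  ; apart = λ { 0 _ → m≢p ∘ sym ; 1 _ → q≢b ; 2 _ → m≢w ; (suc (suc (suc _))) (s≤s (s≤s ())) }
  }
fill (suc n) p q b w q≢b with avoid₂ p b
... | m , m≢p , m≢b = record
  { at = λ { zero → p ; (suc i) → F.at i }
  ; at-0 = refl ; at-1 = F.at-0 ; at-b = F.at-b ; at-w = F.at-w
  ; apart = λ { zero _ eq → m≢p (sym (trans eq F.at-1)) ; (suc i) (s≤s i≤) → F.apart i i≤ }
  }
  where module F = Filling (fill n q m b w m≢b)

same-elements⇒↭ : ∀ {A : Set} {xs ys : List A} → Unique xs → Unique ys →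
                  (∀ {x} → x ∈ xs → x ∈ ys) → (∀ {x} → x ∈ ys → x ∈ xs) → xs ↭ ys
same-elements⇒↭ u v to from = ∼bag⇒↭ (unique∧set⇒bag u v (mk⇔ to from))

module _ {A B : Set} {P : A → Set} (P? : Decidable P) (f : B → A) where

  count-all : ∀ bs as → (∀ b → P (f b)) → length (filter P? (map f bs ++ as)) ≡ length bs + length (filter P? as)
  count-all []       as all = refl
  count-all (b ∷ bs) as all = trans (cong length (filter-accept P? (all b))) (cong suc (count-all bs as all))

  count-none : ∀ bs as → (∀ b → ¬ P (f b)) → length (filter P? (map f bs ++ as)) ≡ length (filter P? as)
  count-none []       as none = refl
  count-none (b ∷ bs) as none = trans (cong length (filter-reject P? (none b))) (count-none bs as none)

-- Degrees in the two colour classes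

module Shading (M : Multigraph) (W : Multigraph.Edge M → Fin 3) where

  open Multigraph

  colouring : EdgeColouring (² M) 2
  colouring (d , b) = shade (W d) b

  degree-colour : ∀ c x → degree (colourClass (² M) colouring c) x ≡
                  sum (map (multiplicity c ∘ W) (filter (incident? M x) (edges M)))
  degree-colour c x = go (edges M)
    where
    Copy : Edge M × Fin 2 → Set
    Copy z = colouring z ≡ c

    copies : ∀ z → List (Copy z)
    copies z = Finite.elements (≡-finite _≟³_ (colouring z) c)

    P? = incident? (colourClass (² M) colouring c) x

    number : ∀ d → length (copies (d , zero)) + length (copies (d , suc zero)) ≡ multiplicity c (W d)
    number d = table (W d) c
      where
      elements : ∀ a b c → List (shade a b ≡ c)
      elements a b c = Finite.elements (≡-finite _≟³_ (shade a b) c)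
      table : ∀ a c → length (elements a zero c) + length (elements a (suc zero) c) ≡ multiplicity c a
      table = from-yes (all? λ a → all? λ c → length (elements a zero c) + length (elements a (suc zero) c) ℕ.≟ multiplicity c a)

    expand : List (Edge M) → List (Edge (colourClass (² M) colouring c))
    expand ds = concatMap (λ z → map (z ,_) (copies z)) (concatMap (λ d → map (d ,_) (allFin 2)) ds)

    go : ∀ ds → length (filter P? (expand ds)) ≡ sum (map (multiplicity c ∘ W) (filter (incident? M x) ds))
    go [] = refl
    go (d ∷ ds) = step (incident? M x d)
      where
      total = sum ∘ map (multiplicity c ∘ W)
      step : Dec (Incident M x d) → length (filter P? (expand (d ∷ ds))) ≡ total (filter (incident? M x) (d ∷ ds))
      step (yes i) = begin
        length (filter P? (expand (d ∷ ds)))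
          ≡⟨ count-all P? ((d , zero) ,_) (copies (d , zero)) _ (λ _ → i) ⟩
        length (copies (d , zero)) + length (filter P? (map ((d , suc zero) ,_) (copies (d , suc zero)) ++ expand ds))
          ≡⟨ cong (length (copies (d , zero)) +_) (count-all P? ((d , suc zero) ,_) (copies (d , suc zero)) _ (λ _ → i)) ⟩
        length (copies (d , zero)) + (length (copies (d , suc zero)) + length (filter P? (expand ds)))
          ≡⟨ ℕ.+-assoc (length (copies (d , zero))) _ _ ⟨
        length (copies (d , zero)) + length (copies (d , suc zero)) + length (filter P? (expand ds))
          ≡⟨ cong₂ _+_ (number d) (go ds) ⟩
        multiplicity c (W d) + sum (map (multiplicity c ∘ W) (filter (incident? M x) ds))
          ≡⟨ cong total (filter-accept (incident? M x) i) ⟨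
        total (filter (incident? M x) (d ∷ ds)) ∎
        where open ≡-Reasoning
      step (no ¬i) = trans (count-none P? ((d , zero) ,_) (copies (d , zero)) _ (λ _ → ¬i))
        (trans (count-none P? ((d , suc zero) ,_) (copies (d , suc zero)) _ (λ _ → ¬i))
        (trans (go ds) (cong total (sym (filter-reject (incident? M x) ¬i)))))

  -- This trades the filtered enumeration of all edges for any explicit duplicate-free list of the
  -- incident ones, such as the two path edges at an inner vertex.
  degree-colour-from : ∀ c x {ds} → Unique ds → (∀ {d} → Incident M x d → d ∈ ds) →
                       (∀ {d} → d ∈ ds → Incident M x d) →
                       degree (colourClass (² M) colouring c) x ≡ sum (map (multiplicity c ∘ W) ds)
  degree-colour-from c x u to from = trans (degree-colour c x) (sum-↭ (↭.map⁺ (multiplicity c ∘ W)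
    (same-elements⇒↭ (Unique.filter⁺ (incident? M x) (Finite.unique (edge-finite M))) u
      (to ∘ proj₂ ∘ ∈-filter⁻ (incident? M x) {xs = edges M})
      (∈-filter⁺ (incident? M x) (Finite.complete (edge-finite M) _) ∘ from))))

-- The colouring of the subdivided graph

module Subdivision (H : Multigraph) (simple : IsSimple H) (cubic : IsCubic H)
                   (inner : Multigraph.Edge H → ℕ)
                   (long : ∀ e → inner e ≡ 0 ⊎ 5 ≤ suc (inner e)) where

  open Multigraph H
  open CubicGraph H simple cubic using (total; incidences; incidences-unique; ∈-incidences; incidences-∈; weighting; weighting-proper)

  M : Multigraph
  M = replaceByPaths H inner

  record PathWeights (e : Edge) : Set where
    field
      at       : ℕ → Fin 3
      at-first : at 0 ≡ weighting e
      at-last  : at (inner e) ≡ weighting e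
      first-ok : 1 ≤ inner e → Compatible (total weighting (proj₁ (ends e))) (at 0) (at 1)
      last-ok  : ∀ k → suc k ≡ inner e → Compatible (total weighting (proj₂ (ends e))) (at (suc k)) (at k)
      apart    : ∀ i → 2 + i ≤ inner e → at i ≢ at (2 + i)

  path-weights : ∀ e → PathWeights e
  path-weights e with inner e in eq | long e
  ... | zero | _ = record
    { at       = λ _ → weighting e
    ; at-first = refl
    ; at-last  = refl
    ; first-ok = λ 1≤k → case subst (1 ≤_) eq 1≤k of λ ()
    ; last-ok  = λ k k≡ → case trans k≡ eq of λ ()
    ; apart    = λ i i≤ → case subst (2 + i ≤_) eq i≤ of λ ()
    }
  ... | suc _ | inj₁ ()
  ... | suc (suc (suc (suc n))) | inj₂ (s≤s (s≤s (s≤s (s≤s (s≤s _))))) = record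
    { at       = F.at
    ; at-first = F.at-0
    ; at-last  = trans (cong F.at eq) F.at-w
    ; first-ok = λ _ → subst₂ (Compatible _) (sym F.at-0) (sym F.at-1) b-ok
    ; last-ok  = λ k k≡ → last k (trans k≡ eq)
    ; apart    = λ i i≤ → F.apart i (ℕ.≤-pred (ℕ.≤-pred (subst (2 + i ≤_) eq i≤)))
    }
    where
    w = weighting e
    pair = compatible-pair w (weighting-proper (e , inj₁ refl))
    b = proj₁ pair
    c = proj₁ (proj₂ pair)
    b-ok = proj₁ (proj₂ (proj₂ pair))
    c-ok = proj₁ (proj₂ (proj₂ (proj₂ pair)))
    module F = Filling (fill n w b c w (proj₂ (proj₂ (proj₂ (proj₂ pair)))))
    last : ∀ k → suc k ≡ 4 + n → Compatible (total weighting (proj₂ (ends e))) (F.at (suc k)) (F.at k)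
    last _ refl = subst₂ (Compatible _) (sym F.at-w) (sym F.at-b) c-ok

  module PW e = PathWeights (path-weights e)

  path-weight : Multigraph.Edge M → Fin 3
  path-weight (e , i) = PW.at e (toℕ i)

  open Shading M path-weight using (colouring; degree-colour-from)

  -- The edge at `v` on the path that replaces `e`, meaningful when `v` is an end of `e`. On an
  -- unreplaced edge both clauses give the only edge there is.
  end-edge : Vertex → Edge → Multigraph.Edge M
  end-edge v e with v ≟ᵛ proj₁ (ends e)
  ... | yes _ = e , zero
  ... | no  _ = e , fromℕ (inner e)

  end-edge-base : ∀ v e → proj₁ (end-edge v e) ≡ e
  end-edge-base v e with v ≟ᵛ proj₁ (ends e)
  ... | yes _ = refl
  ... | no  _ = refl

  end-edge-weight : ∀ v e → path-weight (end-edge v e) ≡ weighting e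
  end-edge-weight v e with v ≟ᵛ proj₁ (ends e)
  ... | yes _ = PW.at-first e
  ... | no  _ = trans (cong (PW.at e) (Fin.toℕ-fromℕ (inner e))) (PW.at-last e)

  degree′ : Fin 2 → Multigraph.Vertex M → ℕ
  degree′ c (inj₁ v)       = sum (map (multiplicity c ∘ weighting) (incidences v))
  degree′ c (inj₂ (e , j)) = multiplicity c (PW.at e (toℕ j)) + multiplicity c (PW.at e (suc (toℕ j)))

  inj₂-injective : ∀ {e i j} → inj₂ (e , i) ≡ (PathVertex H inner ∋ inj₂ (e , j)) → i ≡ j
  inj₂-injective eq = Product.,-injectiveʳ-UIP (Decidable⇒UIP.≡-irrelevant _≟ᵉ_) (Sum.inj₂-injective eq)

  branch-incident : ∀ {v d} → Multigraph.Incident M (inj₁ v) d → d ∈ map (end-edge v) (incidences v)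
  branch-incident {v} {e , i} inc = subst (_∈ map (end-edge v) (incidences v)) (eq i inc)
    (∈-map⁺ (end-edge v) (∈-incidences (incident i inc)))
    where
    incident-target : ∀ {i} (w : View i) → inj₁ v ≡ targetView H inner e w → v ≡ proj₂ (ends e)
    incident-target ‵fromℕ refl = refl

    incident : ∀ i → Multigraph.Incident M (inj₁ v) (e , i) → Incident v e
    incident zero    (inj₁ refl) = inj₁ refl
    incident i       (inj₂ eq)   = inj₂ (incident-target (view i) eq)

    eq-target : ∀ {i} (w : View i) → inj₁ v ≡ targetView H inner e w → end-edge v e ≡ (e , i)
    eq-target ‵fromℕ refl with v ≟ᵛ proj₁ (ends e)
    ... | yes v≡ = contradiction (sym v≡) (loopless e)
    ... | no  _  = refl

    eq : ∀ i → Multigraph.Incident M (inj₁ v) (e , i) → end-edge v e ≡ (e , i)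
    eq zero (inj₁ refl) with v ≟ᵛ v
    ... | yes _  = refl
    ... | no v≢v = contradiction refl v≢v
    eq i (inj₂ p) = eq-target (view i) p

  incident-branch : ∀ {v d} → d ∈ map (end-edge v) (incidences v) → Multigraph.Incident M (inj₁ v) d
  incident-branch {v} d∈ with ∈-map⁻ (end-edge v) d∈
  ... | e , e∈ , refl with v ≟ᵛ proj₁ (ends e) | incidences-∈ {e} e∈
  ... | yes v≡ | _      = inj₁ (cong inj₁ v≡)
  ... | no v≢  | inj₁ p = contradiction p v≢
  ... | no _   | inj₂ p = inj₂ (trans (cong inj₁ p) (sym (cong (targetView H inner e) (view-fromℕ (inner e)))))

  inner-incident : ∀ {e j d} → Multigraph.Incident M (inj₂ (e , j)) d → d ∈ (e , inject₁ j) ∷ (e , suc j) ∷ []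
  inner-incident {d = e , suc i} (inj₁ refl) = there (here refl)
  inner-incident {e} {j} {d = e′ , i} (inj₂ eq) = here (go (view i) eq)
    where
    go : ∀ {i} (w : View i) → inj₂ (e , j) ≡ targetView H inner e′ w → (e′ , i) ≡ (e , inject₁ j)
    go (‵inject₁ i) refl = refl

  incident-inner : ∀ {e j d} → d ∈ (e , inject₁ j) ∷ (e , suc j) ∷ [] → Multigraph.Incident M (inj₂ (e , j)) d
  incident-inner {e} {j} (here refl)         = inj₂ (sym (cong (targetView H inner e) (view-inject₁ j)))
  incident-inner {e} {j} (there (here refl)) = inj₁ refl

  degree-correct : ∀ c x → Multigraph.degree (colourClass (² M) colouring c) x ≡ degree′ c x
  degree-correct c (inj₁ v) = trans
    (degree-colour-from c (inj₁ v) (Unique.map⁺ injective (incidences-unique v)) branch-incident incident-branch)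
    (cong sum (trans (sym (map-∘ (incidences v))) (map-cong (λ e → cong (multiplicity c) (end-edge-weight v e)) (incidences v))))
    where
    injective : ∀ {e f} → end-edge v e ≡ end-edge v f → e ≡ f
    injective {e} {f} eq = trans (sym (end-edge-base v e)) (trans (cong proj₁ eq) (end-edge-base v f))
  degree-correct c (inj₂ (e , j)) = trans
    (degree-colour-from c (inj₂ (e , j)) ((distinct ∷ []) ∷ [] ∷ []) inner-incident incident-inner)
    (cong₂ _+_ (cong (multiplicity c ∘ PW.at e) (Fin.toℕ-inject₁ j)) (ℕ.+-identityʳ _))
    where
    distinct : (e , inject₁ j) ≢ (e , suc j)
    distinct eq = ℕ.1+n≢n (sym (trans (sym (Fin.toℕ-inject₁ j)) (cong toℕ
      (Product.,-injectiveʳ-UIP (Decidable⇒UIP.≡-irrelevant _≟ᵉ_) eq))))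

  -- Equivalent to `multiplicity c a` being at least 1: an edge of weight `a` has a copy of colour
  -- `c`.
  Present : Fin 2 → Fin 3 → Set
  Present zero       a = 1 ≤ toℕ a
  Present (suc zero) a = toℕ a ≤ 1

  shade-present : ∀ a b c → shade a b ≡ c → Present c a
  shade-present zero             b _ refl = z≤n
  shade-present (suc zero)       zero       _ refl = s≤s z≤n
  shade-present (suc zero)       (suc zero) _ refl = s≤s z≤n
  shade-present (suc (suc zero)) b _ refl = s≤s z≤n

  -- Three incident edges with two copies each.
  complement : ∀ v → degree′ (suc zero) (inj₁ v) + total weighting v ≡ 6
  complement v = trans (go (incidences v)) (cong (_* 2) (cubic v))
    where
    go : ∀ es → sum (map (multiplicity (suc zero) ∘ weighting) es) + sum (map (toℕ ∘ weighting) es) ≡ length es * 2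
    go []       = refl
    go (e ∷ es) = trans (interchange (multiplicity (suc zero) (weighting e)) _ _ _)
      (cong₂ _+_ (multiplicity-sum (weighting e)) (go es))

  branch-branch : ∀ c {u v} → Adjacent u v → degree′ c (inj₁ u) ≢ degree′ c (inj₁ v)
  branch-branch zero       a eq = weighting-proper a eq
  branch-branch (suc zero) {u} {v} a eq = weighting-proper a
    (ℕ.+-cancelˡ-≡ (degree′ (suc zero) (inj₁ u)) _ _
      (trans (complement u) (trans (sym (complement v)) (cong (_+ total weighting v) (sym eq)))))

  branch-inner : ∀ c {v a b} → Compatible (total weighting v) a b → Present c a →
                 degree′ c (inj₁ v) ≢ multiplicity c a + multiplicity c b
  branch-inner zero       (ok , _) present eq = ok present eq
  branch-inner (suc zero) {v} {a} {b} (_ , ok) present eq = ok present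
    (ℕ.+-cancelˡ-≡ (multiplicity (suc zero) a + multiplicity (suc zero) b) _ _
      (trans (cong (_+ total weighting v) (sym eq)) (trans (complement v) (sym (four a b)))))
    where
    four : ∀ a b → multiplicity (suc zero) a + multiplicity (suc zero) b + (2 + (toℕ a + toℕ b)) ≡ 6
    four = from-yes (all? λ a → all? λ b →
      multiplicity (suc zero) a + multiplicity (suc zero) b + (2 + (toℕ a + toℕ b)) ℕ.≟ 6)

  -- The index is duplicated, with an equation, so that it can be split as a source by its
  -- constructors and as a target by its view.
  source-target : ∀ c e {i i′} (w : View i′) → i ≡ i′ → Present c (path-weight (e , i)) →
                  degree′ c (source H inner e i) ≢ degree′ c (targetView H inner e w)
  source-target c e {zero}  ‵fromℕ       _  present = branch-branch c (e , inj₁ refl)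
  source-target c e {zero}  (‵inject₁ j) eq present =
    subst (λ k → degree′ c (inj₁ (proj₁ (ends e))) ≢ multiplicity c (PW.at e k) + multiplicity c (PW.at e (suc k))) 0≡j
      (branch-inner c (PW.first-ok e (ℕ.≤-trans (s≤s z≤n) (Fin.toℕ<n j))) present)
    where
    0≡j : 0 ≡ toℕ j
    0≡j = trans (cong toℕ eq) (Fin.toℕ-inject₁ j)
  source-target c e {suc j} ‵fromℕ       eq present deg-eq =
    branch-inner c (PW.last-ok e (toℕ j) (trans (cong toℕ eq) (Fin.toℕ-fromℕ (inner e)))) present
      (trans (sym deg-eq) (ℕ.+-comm (multiplicity c (PW.at e (toℕ j))) _))
  source-target c e {suc j} (‵inject₁ j′) eq present deg-eq =
    -- The two inner vertices share an edge; cancelling its multiplicity leaves the weights two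
    -- places apart.
    PW.apart e (toℕ j) (subst (_≤ inner e) (cong suc (sym 1+j≡j′)) (Fin.toℕ<n j′))
      (multiplicity-injective c _ _ (ℕ.+-cancelʳ-≡ (multiplicity c (PW.at e (suc (toℕ j)))) _ _
        (trans deg-eq (trans (cong (λ k → multiplicity c (PW.at e k) + multiplicity c (PW.at e (suc k))) (sym 1+j≡j′))
          (ℕ.+-comm (multiplicity c (PW.at e (suc (toℕ j)))) _)))))
    where
    1+j≡j′ : suc (toℕ j) ≡ toℕ j′
    1+j≡j′ = trans (cong toℕ eq) (Fin.toℕ-inject₁ j′)

  locally-irregular : IsLocallyIrregularColouring (² M) colouring
  locally-irregular c x y ((((e , i) , b) , shaded) , joins) eq = ends-differ joins
    where
    different : degree′ c (source H inner e i) ≢ degree′ c (target H inner e i)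
    different = source-target c e (view i) refl (shade-present (path-weight (e , i)) b c shaded)

    same : degree′ c x ≡ degree′ c y
    same = trans (sym (degree-correct c x)) (trans eq (degree-correct c y))

    ends-differ : Multigraph.Joins (colourClass (² M) colouring c) (((e , i) , b) , shaded) x y → ⊥
    ends-differ (inj₁ refl) = different same
    ends-differ (inj₂ refl) = different (sym same)

theorem15 : (H : Multigraph) → IsSimple H → IsCubic H →
    (inner : Multigraph.Edge H → ℕ) →
    (∀ e → inner e ≡ 0 ⊎ 5 ≤ suc (inner e)) →
    lir[ ² (replaceByPaths H inner) ]≤ 2
theorem15 H simple cubic inner long = Shading.colouring M path-weight , locally-irregular
  where open Subdivision H simple cubic inner long
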